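{- For every integer $d \geq 2$ and all $k, m \in \mathbb{N}_{+}$, there is a strategy for Presenter in the on-line $(k,d)$ unit interval coloring game that forces Algorithm to use at least $\left\lfloor \frac{5m}{2} \right\rfloor \frac{d}{\log d + 3}$ different colors while the constructed set of intervals is $m\left(\frac{d}{k} + \log d + 3\right)$-colorable. Here $\log$ denotes the logarithm to base $2$.
   Context: Intervals are closed intervals $[l,r]$ on the real line; the length of $[l,r]$ is $r-l$. Each interval carries a $d$-dimensional vector of weights from $[0,1]^d$. Intervals are treated as individual objects: several presented intervals may have the same endpoints. A $(k,d)$-coloring of a finite collection of weighted intervals is an assignment of colors to the intervals such that for each color $\gamma$ and each point $p$ of the real line: the number of intervals containing $p$ and colored $\gamma$ does not exceed $k$, and the sum of the weight vectors of the intervals containing $p$ and colored $\gamma$ does not exceed $1$ in any of the $d$ coordinates. For a real number $x$, a finite collection of weighted intervals is $x$-colorable if it has a $(k,d)$-coloring using at most $x$ colors. The on-line $(k,d)$ unit interval coloring game is played by Presenter and Algorithm. In each round Presenter introduces a new interval of length exactly $1$ with a $d$-dimensional vector of weights from $[0,1]$. Algorithm irrevocably assigns a color to it, before the next interval is introduced, so that the coloring of all intervals presented so far is a $(k,d)$-coloring. Algorithm may use any number of colors and aims to minimize the number of different colors used. Presenter presents finitely many intervals and then the game ends. A strategy for Presenter "forces Algorithm to use at least $c$ colors while the constructed set of intervals is $x$-colorable" if, whatever valid choices Algorithm makes, at the end of the game played against this strategy Algorithm has used at least $c$ different colors and the collection of all presented weighted intervals is $x$-colorable. -}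

module Defs where

open import Data.Nat.Base as ℕ using (ℕ; zero; suc; s≤s; z≤n; ⌊_/2⌋)
import Data.Nat.Properties as ℕₚ
open import Data.Nat.Induction using (<-rec)
open import Data.Nat.Logarithm
  using (⌊log₂_⌋; ⌊log₂⌋-mono-≤; ⌊log₂⌊n/2⌋⌋≡⌊log₂n⌋∸1; ⌊log₂[2^n]⌋≡n)
open import Data.Integer.Base as ℤ using (+_; +≤+)
import Data.Integer.Properties as ℤₚ
open import Data.Rational.Base
  using (ℚ; mkℚ; 0ℚ; 1ℚ; _+_; _-_; _*_; -_; _≤_; _<_; _⊔_; ∣_∣; 1/_; _/_; *<*; ↧ₙ_;
         positive; nonNegative; >-nonZero; toℚᵘ)
open import Data.Rational.Unnormalised.Base as ℚᵘ using (mkℚᵘ)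
import Data.Rational.Unnormalised.Properties as ℚᵘₚ
import Data.Rational.Properties as ℚₚ
open import Data.Rational.Solver using (module +-*-Solver)
open import Data.Fin.Base using (Fin; zero; suc)
open import Data.Fin.Subset using (Subset; inside; outside; _∈_) renaming (∣_∣ to card)
open import Data.List.Base using (length; deduplicate)
open import Data.Vec.Base using (Vec; []; _∷_; lookup; toList)
open import Data.Product.Base using (Σ; ∃; _×_; _,_; proj₁; proj₂)
open import Data.Sum.Base using (inj₁; inj₂)
open import Function.Base using (_∘_)
open import Function.Bundles using (_⇔_)
open import Relation.Nullary.Decidable.Core using (yes; no)
open import Relation.Nullary.Negation.Core using (contradiction)
open import Relation.Binary.PropositionalEquality

-- Cauchy sequences of rationals; equality of real numbers is _≃ᴿ_.

record ℝ : Set where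
  no-eta-equality
  field
    seq    : ℕ → ℚ
    cauchy : ∀ ε → 0ℚ < ε →
             ∃ λ N → ∀ i j → N ℕ.≤ i → N ℕ.≤ j → ∣ seq i - seq j ∣ ≤ ε

open ℝ public

infix 4 _≤ᴿ_ _<ᴿ_ _≃ᴿ_

_≤ᴿ_ : ℝ → ℝ → Set
x ≤ᴿ y = ∀ ε → 0ℚ < ε → ∃ λ N → ∀ i → N ℕ.≤ i → seq x i ≤ seq y i + ε

_<ᴿ_ : ℝ → ℝ → Set
x <ᴿ y = ∃ λ ε → 0ℚ < ε × ∃ λ N → ∀ i → N ℕ.≤ i → seq x i + ε ≤ seq y i

_≃ᴿ_ : ℝ → ℝ → Set
x ≃ᴿ y = x ≤ᴿ y × y ≤ᴿ x

private

  recip : ∀ p → 0ℚ < p → ℚ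
  recip p 0<p = (1/ p) {{>-nonZero 0<p}}

  recip-inverse : ∀ p 0<p → p * recip p 0<p ≡ 1ℚ
  recip-inverse p 0<p = ℚₚ.*-inverseʳ p {{>-nonZero 0<p}}

  0<recip : ∀ p 0<p → 0ℚ < recip p 0<p
  0<recip p 0<p = ℚₚ.positive⁻¹ _ {{ℚₚ.1/pos⇒pos p {{positive 0<p}}}}

  0<* : ∀ {p q} → 0ℚ < p → 0ℚ < q → 0ℚ < p * q
  0<* {p} {q} 0<p 0<q =
    ℚₚ.positive⁻¹ (p * q) {{ℚₚ.pos*pos⇒pos p {{positive 0<p}} q {{positive 0<q}}}}

  split : ∀ ε p → 0ℚ < ε → 0ℚ < p → ∃ λ δ → 0ℚ < δ × p * δ ≡ ε
  split ε p 0<ε 0<p = recip p 0<p * ε , 0<* (0<recip p 0<p) 0<ε ,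
    trans (sym (ℚₚ.*-assoc p (recip p 0<p) ε))
      (trans (cong (_* ε) (recip-inverse p 0<p)) (ℚₚ.*-identityˡ ε))

  0<1 : 0ℚ < 1ℚ
  0<1 = ℚₚ.positive⁻¹ 1ℚ

  halves : ∀ ε → 0ℚ < ε → ∃ λ δ → 0ℚ < δ × δ + δ ≡ ε
  halves ε 0<ε with split ε (1ℚ + 1ℚ) 0<ε (ℚₚ.positive⁻¹ _)
  ... | δ , 0<δ , eq = δ , 0<δ ,
        trans (sym (trans (ℚₚ.*-distribʳ-+ δ 1ℚ 1ℚ)
                          (cong₂ _+_ (ℚₚ.*-identityˡ δ) (ℚₚ.*-identityˡ δ)))) eq

  ≤-+⇒∣-∣≤ : ∀ {a b ε} → a ≤ b + ε → b ≤ a + ε → ∣ a - b ∣ ≤ ε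
  ≤-+⇒∣-∣≤ {a} {b} {ε} p q with ℚₚ.∣p∣≡p∨∣p∣≡-p (a - b)
  ... | inj₁ e = subst₂ _≤_ (sym e)
        (+-*-Solver.solve 2 (λ b e → (b :+ e) :- b := e) refl b ε) (ℚₚ.+-monoˡ-≤ (- b) p)
    where open +-*-Solver
  ... | inj₂ e = subst₂ _≤_
        (trans (+-*-Solver.solve 2 (λ a b → b :- a := :- (a :- b)) refl a b) (sym e))
        (+-*-Solver.solve 2 (λ a e → (a :+ e) :- a := e) refl a ε) (ℚₚ.+-monoˡ-≤ (- a) q)
    where open +-*-Solver

  interchange : ∀ a b c d → (a - b) + (c - d) ≡ (a + c) - (b + d)
  interchange = +-*-Solver.solve 4
    (λ a b c d → (a :- b) :+ (c :- d) := (a :+ c) :- (b :+ d)) refl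
    where open +-*-Solver

  *-difference : ∀ a b c d → a * (c - d) + d * (a - b) ≡ a * c - b * d
  *-difference = +-*-Solver.solve 4
    (λ a b c d → a :* (c :- d) :+ d :* (a :- b) := a :* c :- b :* d) refl
    where open +-*-Solver

  ∣x∣≤∣y∣+∣x-y∣ : ∀ x y → ∣ x ∣ ≤ ∣ y ∣ + ∣ x - y ∣
  ∣x∣≤∣y∣+∣x-y∣ x y = subst (λ z → ∣ z ∣ ≤ ∣ y ∣ + ∣ x - y ∣)
    (+-*-Solver.solve 2 (λ x y → y :+ (x :- y) := x) refl x y) (ℚₚ.∣p+q∣≤∣p∣+∣q∣ y (x - y))
    where open +-*-Solver

  *-mono-≤ : ∀ {a b c d} → 0ℚ ≤ a → a ≤ b → 0ℚ ≤ c → c ≤ d → a * c ≤ b * d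
  *-mono-≤ {a} {b} {c} {d} 0≤a a≤b 0≤c c≤d =
    ℚₚ.≤-trans (ℚₚ.*-monoʳ-≤-nonNeg c {{nonNegative 0≤c}} a≤b)
               (ℚₚ.*-monoˡ-≤-nonNeg b {{nonNegative (ℚₚ.≤-trans 0≤a a≤b)}} c≤d)

  bound : ∀ x → ∃ λ B → 0ℚ < B × ∃ λ N → ∀ i → N ℕ.≤ i → ∣ seq x i ∣ ≤ B
  bound x with cauchy x 1ℚ 0<1
  ... | N , h = ∣ seq x N ∣ + 1ℚ
              , ℚₚ.≤-<-trans (ℚₚ.0≤∣p∣ (seq x N))
                  (subst (_< ∣ seq x N ∣ + 1ℚ) (ℚₚ.+-identityʳ _) (ℚₚ.+-monoʳ-< ∣ seq x N ∣ 0<1))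
              , N
              , λ i N≤i → ℚₚ.≤-trans (∣x∣≤∣y∣+∣x-y∣ (seq x i) (seq x N))
                                      (ℚₚ.+-monoʳ-≤ ∣ seq x N ∣ (h i N N≤i ℕₚ.≤-refl))

fromℚ : ℚ → ℝ
fromℚ q .seq _          = q
fromℚ q .cauchy ε 0<ε = 0 , λ _ _ _ _ →
  subst (λ z → ∣ z ∣ ≤ ε) (sym (ℚₚ.+-inverseʳ q)) (ℚₚ.<⇒≤ 0<ε)

fromℕ : ℕ → ℝ
fromℕ n = fromℚ (+ n / 1)

0ᴿ 1ᴿ : ℝ
0ᴿ = fromℚ 0ℚ
1ᴿ = fromℚ 1ℚ

infixl 6 _+ᴿ_ _-ᴿ_
infixl 7 _*ᴿ_
infix  8 -ᴿ_

_+ᴿ_ : ℝ → ℝ → ℝ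
(x +ᴿ y) .seq i = seq x i + seq y i
(x +ᴿ y) .cauchy ε 0<ε with halves ε 0<ε
... | δ , 0<δ , δ+δ≡ε with cauchy x δ 0<δ | cauchy y δ 0<δ
... | M , hx | N , hy = M ℕ.⊔ N , λ i j ≤i ≤j →
  subst₂ _≤_
    (cong ∣_∣ (interchange (seq x i) (seq x j) (seq y i) (seq y j)))
    δ+δ≡ε
    (ℚₚ.≤-trans (ℚₚ.∣p+q∣≤∣p∣+∣q∣ (seq x i - seq x j) (seq y i - seq y j))
      (ℚₚ.+-mono-≤ (hx i j (ℕₚ.m⊔n≤o⇒m≤o M N ≤i) (ℕₚ.m⊔n≤o⇒m≤o M N ≤j))
                   (hy i j (ℕₚ.m⊔n≤o⇒n≤o M N ≤i) (ℕₚ.m⊔n≤o⇒n≤o M N ≤j))))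

-ᴿ_ : ℝ → ℝ
(-ᴿ x) .seq i = - seq x i
(-ᴿ x) .cauchy ε 0<ε with cauchy x ε 0<ε
... | N , h = N , λ i j N≤i N≤j →
  subst (_≤ ε) (trans (sym (ℚₚ.∣-p∣≡∣p∣ (seq x i - seq x j)))
                      (cong ∣_∣ (ℚₚ.neg-distrib-+ (seq x i) (- seq x j))))
    (h i j N≤i N≤j)

_-ᴿ_ : ℝ → ℝ → ℝ
x -ᴿ y = x +ᴿ (-ᴿ y)

_*ᴿ_ : ℝ → ℝ → ℝ
(x *ᴿ y) .seq i = seq x i * seq y i
(x *ᴿ y) .cauchy ε 0<ε = fromBounds (bound x) (bound y)
  where
  Bound : ℝ → Set
  Bound x = ∃ λ B → 0ℚ < B × ∃ λ N → ∀ i → N ℕ.≤ i → ∣ seq x i ∣ ≤ B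
  Modulus : ℝ → ℚ → Set
  Modulus x δ = ∃ λ N → ∀ i j → N ℕ.≤ i → N ℕ.≤ j → ∣ seq x i - seq x j ∣ ≤ δ
  Goal : Set
  Goal = ∃ λ N → ∀ i j → N ℕ.≤ i → N ℕ.≤ j → ∣ seq x i * seq y i - seq x j * seq y j ∣ ≤ ε
  estimate : ∀ B C δ a b c d → (B + C) * δ ≡ ε → ∣ a ∣ ≤ B → ∣ d ∣ ≤ C →
             ∣ c - d ∣ ≤ δ → ∣ a - b ∣ ≤ δ → ∣ a * c - b * d ∣ ≤ ε
  estimate B C δ a b c d eq a≤B d≤C c-d≤δ a-b≤δ = begin
    ∣ a * c - b * d ∣                     ≡⟨ cong ∣_∣ (*-difference a b c d) ⟨
    ∣ a * (c - d) + d * (a - b) ∣         ≤⟨ ℚₚ.∣p+q∣≤∣p∣+∣q∣ (a * (c - d)) (d * (a - b)) ⟩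
    ∣ a * (c - d) ∣ + ∣ d * (a - b) ∣     ≡⟨ cong₂ _+_ (ℚₚ.∣p*q∣≡∣p∣*∣q∣ a (c - d)) (ℚₚ.∣p*q∣≡∣p∣*∣q∣ d (a - b)) ⟩
    ∣ a ∣ * ∣ c - d ∣ + ∣ d ∣ * ∣ a - b ∣ ≤⟨ ℚₚ.+-mono-≤
                                              (*-mono-≤ (ℚₚ.0≤∣p∣ a) a≤B (ℚₚ.0≤∣p∣ (c - d)) c-d≤δ)
                                              (*-mono-≤ (ℚₚ.0≤∣p∣ d) d≤C (ℚₚ.0≤∣p∣ (a - b)) a-b≤δ) ⟩
    B * δ + C * δ                         ≡⟨ ℚₚ.*-distribʳ-+ δ B C ⟨
    (B + C) * δ                           ≡⟨ eq ⟩
    ε                                     ∎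
    where open ℚₚ.≤-Reasoning
  fromModuli : ∀ B C δ → (B + C) * δ ≡ ε → ∀ K L →
               (∀ i → K ℕ.≤ i → ∣ seq x i ∣ ≤ B) → (∀ i → L ℕ.≤ i → ∣ seq y i ∣ ≤ C) →
               Modulus x δ → Modulus y δ → Goal
  fromModuli B C δ eq K L hB hC (M , hx) (N , hy) = (K ℕ.⊔ L) ℕ.⊔ (M ℕ.⊔ N) , λ i j ≤i ≤j →
    let ≤i₁ = ℕₚ.m⊔n≤o⇒m≤o (K ℕ.⊔ L) (M ℕ.⊔ N) ≤i ; ≤i₂ = ℕₚ.m⊔n≤o⇒n≤o (K ℕ.⊔ L) (M ℕ.⊔ N) ≤i
        ≤j₁ = ℕₚ.m⊔n≤o⇒m≤o (K ℕ.⊔ L) (M ℕ.⊔ N) ≤j ; ≤j₂ = ℕₚ.m⊔n≤o⇒n≤o (K ℕ.⊔ L) (M ℕ.⊔ N) ≤j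
    in estimate B C δ (seq x i) (seq x j) (seq y i) (seq y j) eq
         (hB i (ℕₚ.m⊔n≤o⇒m≤o K L ≤i₁)) (hC j (ℕₚ.m⊔n≤o⇒n≤o K L ≤j₁))
         (hy i j (ℕₚ.m⊔n≤o⇒n≤o M N ≤i₂) (ℕₚ.m⊔n≤o⇒n≤o M N ≤j₂))
         (hx i j (ℕₚ.m⊔n≤o⇒m≤o M N ≤i₂) (ℕₚ.m⊔n≤o⇒m≤o M N ≤j₂))
  fromSplit : ∀ B C → (∃ λ δ → 0ℚ < δ × (B + C) * δ ≡ ε) → ∀ K L →
              (∀ i → K ℕ.≤ i → ∣ seq x i ∣ ≤ B) → (∀ i → L ℕ.≤ i → ∣ seq y i ∣ ≤ C) → Goal
  fromSplit B C (δ , 0<δ , eq) K L hB hC =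
    fromModuli B C δ eq K L hB hC (cauchy x δ 0<δ) (cauchy y δ 0<δ)
  fromBounds : Bound x → Bound y → Goal
  fromBounds (B , 0<B , K , hB) (C , 0<C , L , hC) =
    fromSplit B C (split ε (B + C) 0<ε (ℚₚ.+-mono-< 0<B 0<C)) K L hB hC

private

  0<⊔ : ∀ {ε} → 0ℚ < ε → ∀ q → 0ℚ < ε ⊔ q
  0<⊔ {ε} 0<ε q = ℚₚ.<-≤-trans 0<ε (ℚₚ.p≤p⊔q ε q)

  ∣-∣≤⇒≤-+ : ∀ a b {ε} → ∣ a - b ∣ ≤ ε → a ≤ b + ε
  ∣-∣≤⇒≤-+ a b {ε} h = subst (_≤ b + ε)
    (solve 2 (λ a b → b :+ (a :- b) := a) refl a b)
    (ℚₚ.+-monoʳ-≤ b (ℚₚ.≤-trans (p≤∣p∣ (a - b)) h))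
    where
    open +-*-Solver
    p≤∣p∣ : ∀ p → p ≤ ∣ p ∣
    p≤∣p∣ p with ℚₚ.≤-total 0ℚ p
    ... | inj₁ 0≤p = ℚₚ.≤-reflexive (sym (ℚₚ.0≤p⇒∣p∣≡p 0≤p))
    ... | inj₂ p≤0 = ℚₚ.≤-trans p≤0 (ℚₚ.0≤∣p∣ p)

  -- p ≤ q + δ gives 1/q ≤ 1/p + δ/(pq).
  recip-≤ : ∀ p q 0<p 0<q {δ} → p ≤ q + δ →
            recip q 0<q ≤ recip p 0<p + δ * (recip p 0<p * recip q 0<q)
  recip-≤ p q 0<p 0<q {δ} h = subst₂ _≤_
    (trans (sym (ℚₚ.*-assoc p p⁻¹ q⁻¹))
      (trans (cong (_* q⁻¹) (recip-inverse p 0<p)) (ℚₚ.*-identityˡ q⁻¹)))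
    (trans (solve 4 (λ q δ a b → (q :+ δ) :* (a :* b) := (q :* b) :* a :+ δ :* (a :* b))
              refl q δ p⁻¹ q⁻¹)
      (cong (_+ δ * (p⁻¹ * q⁻¹))
        (trans (cong (_* p⁻¹) (recip-inverse q 0<q)) (ℚₚ.*-identityˡ p⁻¹))))
    (ℚₚ.*-monoʳ-≤-nonNeg (p⁻¹ * q⁻¹) {{nonNegative 0≤p⁻¹q⁻¹}} h)
    where
    open +-*-Solver
    p⁻¹ = recip p 0<p
    q⁻¹ = recip q 0<q
    0≤p⁻¹q⁻¹ : 0ℚ ≤ p⁻¹ * q⁻¹
    0≤p⁻¹q⁻¹ = ℚₚ.<⇒≤ (0<* (0<recip p 0<p) (0<recip q 0<q))

  recip-antimono : ∀ p q 0<p 0<q → p ≤ q → recip q 0<q ≤ recip p 0<p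
  recip-antimono p q 0<p 0<q p≤q = subst (recip q 0<q ≤_)
    (trans (cong (λ u → recip p 0<p + u) (ℚₚ.*-zeroˡ (recip p 0<p * recip q 0<q)))
           (ℚₚ.+-identityʳ (recip p 0<p)))
    (recip-≤ p q 0<p 0<q (subst (p ≤_) (sym (ℚₚ.+-identityʳ q)) p≤q))

-- The terms of y are replaced by their maximum with the lower bound that
-- witnesses 0 < y: this alters only finitely many of them, and it makes all of
-- them invertible.

recipᴿ : ∀ y → 0ᴿ <ᴿ y → ℝ
recipᴿ y (ε , 0<ε , _) .seq i = recip (ε ⊔ seq y i) (0<⊔ 0<ε (seq y i))
recipᴿ y (ε , 0<ε , N , h) .cauchy η 0<η
  with cauchy y (ε * ε * η) (0<* (0<* 0<ε 0<ε) 0<η)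
... | M , hM = N ℕ.⊔ M , λ i j ≤i ≤j → ≤-+⇒∣-∣≤ (half j i ≤j ≤i) (half i j ≤i ≤j)
  where
  open +-*-Solver
  z : ℕ → ℚ
  z i = ε ⊔ seq y i
  0<z : ∀ i → 0ℚ < z i
  0<z i = 0<⊔ 0<ε (seq y i)
  z⁻¹ : ℕ → ℚ
  z⁻¹ i = recip (z i) (0<z i)
  z≡ : ∀ i → N ℕ.≤ i → z i ≡ seq y i
  z≡ i N≤i = ℚₚ.p≤q⇒p⊔q≡q (subst (_≤ seq y i) (ℚₚ.+-identityˡ ε) (h i N≤i))
  z⁻¹≤ : ∀ i → z⁻¹ i ≤ recip ε 0<ε
  z⁻¹≤ i = recip-antimono ε (z i) 0<ε (0<z i) (ℚₚ.p≤p⊔q ε (seq y i))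
  0≤z⁻¹ : ∀ i → 0ℚ ≤ z⁻¹ i
  0≤z⁻¹ i = ℚₚ.<⇒≤ (0<recip (z i) (0<z i))
  δ = ε * ε * η
  ε⁻¹ = recip ε 0<ε
  δε⁻²≡η : δ * (ε⁻¹ * ε⁻¹) ≡ η
  δε⁻²≡η = trans (solve 3 (λ e η f → (e :* e :* η) :* (f :* f) := (e :* f) :* ((e :* f) :* η))
                    refl ε η ε⁻¹)
    (trans (cong (λ u → u * (u * η)) (recip-inverse ε 0<ε))
      (trans (ℚₚ.*-identityˡ (1ℚ * η)) (ℚₚ.*-identityˡ η)))
  half : ∀ i j → N ℕ.⊔ M ℕ.≤ i → N ℕ.⊔ M ℕ.≤ j → z⁻¹ j ≤ z⁻¹ i + η
  half i j ≤i ≤j = ℚₚ.≤-trans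
    (recip-≤ (z i) (z j) (0<z i) (0<z j)
      (subst₂ (λ u v → u ≤ v + δ) (sym (z≡ i (ℕₚ.m⊔n≤o⇒m≤o N M ≤i)))
                                  (sym (z≡ j (ℕₚ.m⊔n≤o⇒m≤o N M ≤j)))
        (∣-∣≤⇒≤-+ (seq y i) (seq y j)
          (hM i j (ℕₚ.m⊔n≤o⇒n≤o N M ≤i) (ℕₚ.m⊔n≤o⇒n≤o N M ≤j)))))
    (ℚₚ.+-monoʳ-≤ (z⁻¹ i) (ℚₚ.≤-trans
      (*-mono-≤ (ℚₚ.<⇒≤ (0<* (0<* 0<ε 0<ε) 0<η)) ℚₚ.≤-refl
        (ℚₚ.<⇒≤ (0<* (0<recip (z i) (0<z i)) (0<recip (z j) (0<z j))))
        (*-mono-≤ (0≤z⁻¹ i) (z⁻¹≤ i) (0≤z⁻¹ j) (z⁻¹≤ j)))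
      (ℚₚ.≤-reflexive δε⁻²≡η)))

infixl 7 _÷ᴿ_⟨_⟩

_÷ᴿ_⟨_⟩ : ∀ x y → 0ᴿ <ᴿ y → ℝ
x ÷ᴿ y ⟨ 0<y ⟩ = x *ᴿ recipᴿ y 0<y

log-term : ℕ → ℕ → ℕ
log-term n i = ⌊log₂ (n ℕ.^ suc i) ⌋

private

  ⌊log₂⌋-upper : ∀ n → n ℕ.< 2 ℕ.^ suc ⌊log₂ n ⌋
  ⌊log₂⌋-upper n with n ℕₚ.<? 2 ℕ.^ suc ⌊log₂ n ⌋
  ... | yes p = p
  ... | no ¬p = contradiction
    (subst (ℕ._≤ ⌊log₂ n ⌋) (⌊log₂[2^n]⌋≡n (suc ⌊log₂ n ⌋)) (⌊log₂⌋-mono-≤ (ℕₚ.≮⇒≥ ¬p)))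
    ℕₚ.1+n≰n

  ⌊log₂⌋-lower : ∀ n → .{{ℕ.NonZero n}} → 2 ℕ.^ ⌊log₂ n ⌋ ℕ.≤ n
  ⌊log₂⌋-lower = <-rec (λ n → .{{ℕ.NonZero n}} → 2 ℕ.^ ⌊log₂ n ⌋ ℕ.≤ n) step
    where
    step : ∀ n → (∀ {m} → m ℕ.< n → .{{ℕ.NonZero m}} → 2 ℕ.^ ⌊log₂ m ⌋ ℕ.≤ m) →
           .{{ℕ.NonZero n}} → 2 ℕ.^ ⌊log₂ n ⌋ ℕ.≤ n
    step 1 rec = s≤s z≤n
    step n@(suc (suc m)) rec = subst (λ e → 2 ℕ.^ e ℕ.≤ n) eq
      (ℕₚ.≤-trans (ℕₚ.*-monoʳ-≤ 2 (rec (ℕₚ.⌊n/2⌋<n (suc m)))) 2*⌊n/2⌋≤n)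
      where
      1≤ : 1 ℕ.≤ ⌊log₂ n ⌋
      1≤ = ⌊log₂⌋-mono-≤ {2} {n} (s≤s (s≤s z≤n))
      eq : suc ⌊log₂ ⌊ n /2⌋ ⌋ ≡ ⌊log₂ n ⌋
      eq = trans (cong suc (⌊log₂⌊n/2⌋⌋≡⌊log₂n⌋∸1 n)) (ℕₚ.m+[n∸m]≡n 1≤)
      2*⌊n/2⌋≤n : 2 ℕ.* ⌊ n /2⌋ ℕ.≤ n
      2*⌊n/2⌋≤n = subst₂ ℕ._≤_ (cong (⌊ n /2⌋ ℕ.+_) (sym (ℕₚ.+-identityʳ ⌊ n /2⌋)))
        (ℕₚ.⌊n/2⌋+⌈n/2⌉≡n n) (ℕₚ.+-monoʳ-≤ ⌊ n /2⌋ (ℕₚ.⌊n/2⌋≤⌈n/2⌉ n))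

  /-mono-≤ : ∀ a b m n → .{{_ : ℕ.NonZero m}} → .{{_ : ℕ.NonZero n}} →
             a ℕ.* n ℕ.≤ b ℕ.* m → + a / m ≤ + b / n
  /-mono-≤ a b (suc m) (suc n) h = ℚₚ.toℚᵘ-cancel-≤ (begin
    toℚᵘ (+ a / suc m) ≃⟨ ℚₚ.toℚᵘ-fromℚᵘ (mkℚᵘ (+ a) m) ⟩
    mkℚᵘ (+ a) m       ≤⟨ ℚᵘ.*≤* (subst₂ ℤ._≤_ (ℤₚ.pos-* a (suc n)) (ℤₚ.pos-* b (suc m)) (+≤+ h)) ⟩
    mkℚᵘ (+ b) n       ≃⟨ ℚₚ.toℚᵘ-fromℚᵘ (mkℚᵘ (+ b) n) ⟨
    toℚᵘ (+ b / suc n) ∎)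
    where open ℚᵘₚ.≤-Reasoning

  /-+ : ∀ a b n → .{{_ : ℕ.NonZero n}} → + a / n + + b / n ≡ + (a ℕ.+ b) / n
  /-+ a b (suc n) = ℚₚ.toℚᵘ-injective (begin
    toℚᵘ (+ a / suc n + + b / suc n)             ≈⟨ ℚₚ.toℚᵘ-homo-+ (+ a / suc n) (+ b / suc n) ⟩
    toℚᵘ (+ a / suc n) ℚᵘ.+ toℚᵘ (+ b / suc n)   ≈⟨ ℚᵘₚ.+-cong (ℚₚ.toℚᵘ-fromℚᵘ (mkℚᵘ (+ a) n))
                                                              (ℚₚ.toℚᵘ-fromℚᵘ (mkℚᵘ (+ b) n)) ⟩
    mkℚᵘ (+ a) n ℚᵘ.+ mkℚᵘ (+ b) n               ≈⟨ ℚᵘ.*≡* eq ⟩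
    mkℚᵘ (+ (a ℕ.+ b)) n                         ≈⟨ ℚₚ.toℚᵘ-fromℚᵘ (mkℚᵘ (+ (a ℕ.+ b)) n) ⟨
    toℚᵘ (+ (a ℕ.+ b) / suc n)                   ∎)
    where
    open import Relation.Binary.Reasoning.Setoid ℚᵘₚ.≃-setoid
    eq : (+ a ℤ.* + suc n ℤ.+ + b ℤ.* + suc n) ℤ.* + suc n ≡ + (a ℕ.+ b) ℤ.* + (suc n ℕ.* suc n)
    eq = trans (cong (ℤ._* + suc n) (sym (ℤₚ.*-distribʳ-+ (+ suc n) (+ a) (+ b))))
        (trans (ℤₚ.*-assoc (+ (a ℕ.+ b)) (+ suc n) (+ suc n))
               (cong (+ (a ℕ.+ b) ℤ.*_) (sym (ℤₚ.pos-* (suc n) (suc n)))))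

  archimedean : ∀ ε → 0ℚ < ε → ∃ λ N → ∀ i → N ℕ.≤ i → + 1 / suc i ≤ ε
  archimedean ε 0<ε = ↧ₙ ε , λ i N≤i → go ε 0<ε i N≤i
    where
    go : ∀ ε → 0ℚ < ε → ∀ i → ↧ₙ ε ℕ.≤ i → + 1 / suc i ≤ ε
    go ε@(mkℚ (+ zero) d c) 0<ε i N≤i = contradiction (ℚₚ.drop-*<* 0<ε) λ { (ℤ.+<+ ()) }
    go ε@(mkℚ (+ suc p) d c) 0<ε i N≤i = subst (+ 1 / suc i ≤_) (ℚₚ.↥p/↧p≡p ε)
      (/-mono-≤ 1 (suc p) (suc i) (suc d)
        (ℕₚ.*-mono-≤ (s≤s (z≤n {p})) (ℕₚ.m≤n⇒m≤1+n N≤i)))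
    go ε@(mkℚ ℤ.-[1+ p ] d c) 0<ε i N≤i = contradiction (ℚₚ.drop-*<* 0<ε) λ ()

  /-≤-/+ : ∀ a b m n {ε} → .{{_ : ℕ.NonZero m}} → + 1 / suc n ≤ ε →
           a ℕ.* suc n ℕ.≤ suc b ℕ.* m → + a / m ≤ + b / suc n + ε
  /-≤-/+ a b m n {ε} 1/n≤ε h = begin
    + a / m                   ≤⟨ /-mono-≤ a (suc b) m (suc n) h ⟩
    + suc b / suc n           ≡⟨ cong (λ c → + c / suc n) (ℕₚ.+-comm 1 b) ⟩
    + (b ℕ.+ 1) / suc n       ≡⟨ /-+ b 1 (suc n) ⟨
    + b / suc n + + 1 / suc n ≤⟨ ℚₚ.+-monoʳ-≤ (+ b / suc n) 1/n≤ε ⟩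
    + b / suc n + ε           ∎
    where open ℚₚ.≤-Reasoning

  2^-cancel-≤ : ∀ {a b} → 2 ℕ.^ a ℕ.≤ 2 ℕ.^ b → a ℕ.≤ b
  2^-cancel-≤ {a} {b} h = subst₂ ℕ._≤_ (⌊log₂[2^n]⌋≡n a) (⌊log₂[2^n]⌋≡n b) (⌊log₂⌋-mono-≤ h)

  -- If 2 ^ a ≤ n ^ i and n ^ j ≤ 2 ^ b then a / i ≤ log₂ n ≤ b / j.
  compare : ∀ n a b i j → 2 ℕ.^ a ℕ.≤ n ℕ.^ i → n ℕ.^ j ℕ.≤ 2 ℕ.^ b → a ℕ.* j ℕ.≤ b ℕ.* i
  compare n a b i j h k = 2^-cancel-≤ (begin
    2 ℕ.^ (a ℕ.* j)   ≡⟨ ℕₚ.^-*-assoc 2 a j ⟨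
    (2 ℕ.^ a) ℕ.^ j   ≤⟨ ℕₚ.^-monoˡ-≤ j h ⟩
    (n ℕ.^ i) ℕ.^ j   ≡⟨ ℕₚ.^-*-assoc n i j ⟩
    n ℕ.^ (i ℕ.* j)   ≡⟨ cong (n ℕ.^_) (ℕₚ.*-comm i j) ⟩
    n ℕ.^ (j ℕ.* i)   ≡⟨ ℕₚ.^-*-assoc n j i ⟨
    (n ℕ.^ j) ℕ.^ i   ≤⟨ ℕₚ.^-monoˡ-≤ i k ⟩
    (2 ℕ.^ b) ℕ.^ i   ≡⟨ ℕₚ.^-*-assoc 2 b i ⟩
    2 ℕ.^ (b ℕ.* i)   ∎)
    where open ℕₚ.≤-Reasoning

  log-term-lower : ∀ n → .{{ℕ.NonZero n}} → ∀ i → 2 ℕ.^ log-term n i ℕ.≤ n ℕ.^ suc i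
  log-term-lower n i = ⌊log₂⌋-lower (n ℕ.^ suc i) {{ℕₚ.m^n≢0 n (suc i)}}

  log-term-upper : ∀ n i → n ℕ.^ suc i ℕ.≤ 2 ℕ.^ suc (log-term n i)
  log-term-upper n i = ℕₚ.<⇒≤ (⌊log₂⌋-upper (n ℕ.^ suc i))

-- The term of index j ∸ 1 is ⌊log₂ (n ^ j)⌋ / j, which is within 1 / j of log₂ n.

log₂ : (n : ℕ) → .{{ℕ.NonZero n}} → ℝ
log₂ n .seq i = + log-term n i / suc i
log₂ n .cauchy ε 0<ε = proj₁ N , λ i j ≤i ≤j →
  ≤-+⇒∣-∣≤ {+ log-term n i / suc i} {+ log-term n j / suc j} (half i j ≤j) (half j i ≤i)
  where
  N = archimedean ε 0<ε
  half : ∀ i j → proj₁ N ℕ.≤ j → + log-term n i / suc i ≤ + log-term n j / suc j + ε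
  half i j N≤j = /-≤-/+ (log-term n i) (log-term n j) (suc i) j (proj₂ N j N≤j)
    (compare n (log-term n i) (suc (log-term n j)) (suc i) (suc j)
      (log-term-lower n i) (log-term-upper n j))

-- These two bounds determine log₂ n, since for all p and q one of them applies.

2^p≤n^q⇒p/q≤log₂n : ∀ n p q → .{{_ : ℕ.NonZero n}} → .{{_ : ℕ.NonZero q}} →
                     2 ℕ.^ p ℕ.≤ n ℕ.^ q → fromℚ (+ p / q) ≤ᴿ log₂ n
2^p≤n^q⇒p/q≤log₂n n p q h ε 0<ε = proj₁ N , λ i N≤i →
  /-≤-/+ p (log-term n i) q i (proj₂ N i N≤i)
    (compare n p (suc (log-term n i)) q (suc i) h (log-term-upper n i))
  where N = archimedean ε 0<ε

n^q≤2^p⇒log₂n≤p/q : ∀ n p q → .{{_ : ℕ.NonZero n}} → .{{_ : ℕ.NonZero q}} →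
                     n ℕ.^ q ℕ.≤ 2 ℕ.^ p → log₂ n ≤ᴿ fromℚ (+ p / q)
n^q≤2^p⇒log₂n≤p/q n p q h ε 0<ε = 0 , λ i _ → ℚₚ.≤-trans
  (/-mono-≤ (log-term n i) p (suc i) q
    (compare n (log-term n i) p (suc i) q (log-term-lower n i) h))
  (subst (_≤ + p / q + ε) (ℚₚ.+-identityʳ (+ p / q)) (ℚₚ.+-monoʳ-≤ (+ p / q) (ℚₚ.<⇒≤ 0<ε)))

0<log₂n+3 : ∀ n → .{{_ : ℕ.NonZero n}} → 0ᴿ <ᴿ log₂ n +ᴿ fromℕ 3
0<log₂n+3 n = + 3 / 1 , ℚₚ.positive⁻¹ _ , 0 , λ i _ →
  ℚₚ.+-monoˡ-≤ (+ 3 / 1) (/-mono-≤ 0 (log-term n i) 1 (suc i) z≤n)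

record WeightedInterval (d : ℕ) : Set where
  field
    left right : ℝ
    left≤right : left ≤ᴿ right
    weight     : Fin d → ℝ
    0≤weight   : ∀ j → 0ᴿ ≤ᴿ weight j
    weight≤1   : ∀ j → weight j ≤ᴿ 1ᴿ

  len : ℝ
  len = right -ᴿ left

open WeightedInterval public

IsUnit : ∀ {d} → WeightedInterval d → Set
IsUnit I = len I ≃ᴿ 1ᴿ

infix 4 _contains_

_contains_ : ∀ {d} → WeightedInterval d → ℝ → Set
I contains p = left I ≤ᴿ p × p ≤ᴿ right I

∑[_] : ∀ {n} → Subset n → (Fin n → ℝ) → ℝ
∑[ [] ]          f = 0ᴿ
∑[ inside  ∷ S ] f = f zero +ᴿ ∑[ S ] (f ∘ suc)
∑[ outside ∷ S ] f = ∑[ S ] (f ∘ suc)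

-- The i-th interval of Is has the i-th color of cs. Membership of a real point
-- in an interval is not decidable, so the set of intervals containing p and
-- colored γ is not computed from p and γ but is any S having these elements.

IsColoring : ∀ {d n} → ℕ → Vec (WeightedInterval d) n → Vec ℕ n → Set
IsColoring {d} {n} k Is cs =
  ∀ (γ : ℕ) (p : ℝ) (S : Subset n) →
  (∀ i → i ∈ S ⇔ (lookup Is i contains p × lookup cs i ≡ γ)) →
  card S ℕ.≤ k × (∀ j → ∑[ S ] (λ i → weight (lookup Is i) j) ≤ᴿ 1ᴿ)

#colors : ∀ {n} → Vec ℕ n → ℕ
#colors cs = length (deduplicate ℕₚ._≟_ (toList cs))

Colorable : ∀ {d n} → ℕ → ℝ → Vec (WeightedInterval d) n → Set
Colorable {n = n} k x Is =
  Σ (Vec ℕ n) λ cs → IsColoring k Is cs × fromℕ (#colors cs) ≤ᴿ x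

-- The next move of Presenter depends on the colors given so far. A strategy is
-- a well-founded tree, so every play against it is finite.

data Strategy (d : ℕ) : Set where
  stop    : Strategy d
  present : (I : WeightedInterval d) → IsUnit I → (ℕ → Strategy d) → Strategy d

-- Every play that continues from the presented intervals Is, colored cs, with
-- Presenter following the given strategy and Algorithm keeping a (k,d)-coloring
-- in each round, ends in a position satisfying P.

Ensures : ∀ {d} (k : ℕ) (P : ∀ {n} → Vec (WeightedInterval d) n → Vec ℕ n → Set) →
          ∀ {n} → Vec (WeightedInterval d) n → Vec ℕ n → Strategy d → Set
Ensures k P Is cs stop               = P Is cs
Ensures k P Is cs (present I _ next) =
  ∀ γ → IsColoring k (I ∷ Is) (γ ∷ cs) → Ensures k P (I ∷ Is) (γ ∷ cs) (next γ)

ForcesWhileColorable : ∀ {d} → ℕ → Strategy d → ℝ → ℝ → Set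
ForcesWhileColorable k σ c x =
  Ensures k (λ Is cs → c ≤ᴿ fromℕ (#colors cs) × Colorable k x Is) [] [] σ

{-# OPTIONS --safe #-}
module Submission where

-- A group of d intervals with the same endpoints is played as in the lower bound
-- of Halldórsson and Szegedy for on-line graph coloring. Before each interval
-- Presenter fixes a set A of at most h = ⌊(⌊log₂ d⌋ + 3) / 2⌋ of the
-- ⌊log₂ d⌋ + 3 hues that differs from the set of hues of every color used so
-- far, and weights that make the interval conflict exactly with the earlier ones
-- whose hue is not in A. So the hues of the color chosen by Algorithm form a
-- proper subset of A, and the interval gets a hue in the difference. Each color
-- occurs at most h times in the group, hence there are at least
-- d / h ≥ 2d / (log₂ d + 3) of them, whereas the hue classes, split into parts of
-- at most k intervals, are d / k + log₂ d + 3 color classes of a valid coloring.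
-- Groups that touch conflict completely, so their colors are disjoint.
--
-- With p = ⌊m/2⌋ and q = ⌈m/2⌉, play p groups at 0 and p groups at 6/4. If
-- together they use 3/2 times the colors forced at one place, then q groups at
-- 3/4, which touch both, finish. Otherwise at least half of these colors occur
-- at both places. Then play p groups at 1/4, touching those at 0, and q groups at
-- 5/4, touching those at 1/4 and at 6/4: none of them can use the shared colors.

open import Defs
open import Data.Bool.Base using (Bool; true; false; not; if_then_else_)
import Data.Bool.Properties as Boolₚ
open import Data.Fin.Base as Fin using (Fin; zero; suc; toℕ; fromℕ<)
open import Data.Fin.Patterns
import Data.Fin.Properties as Finₚ
open import Data.Fin.Subset
  using (Subset; inside; outside; _∈_; _∉_; _⊆_; _∪_; ⁅_⁆; ⊥; ∁; Nonempty) renaming (∣_∣ to card)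
open import Data.Fin.Subset.Properties
  using (_∈?_; ∉⊥; ⊆-antisym; x∈p∪q⁻; x∈p∪q⁺; x∈⁅x⁆; x∈⁅y⁆⇒x≡y; q⊆p∪q; p⊂q⇒∣p∣<∣q∣; p⊆q⇒∣p∣≤∣q∣;
         ∣⊥∣≡0; ∣p∣≤n; ∣∁p∣≡n∸∣p∣; nonempty?; drop-there)
import Data.Integer.Base as ℤ
import Data.Integer.Properties as ℤₚ
open import Data.List.Base as List using (List; []; _∷_; length; filter; deduplicate; upTo)
import Data.List.Membership.Propositional as L
import Data.List.Membership.Propositional.Properties as Lₚ
open import Data.List.Membership.DecPropositional using () renaming (_∈?_ to member?)
import Data.List.Properties as Listₚ
import Data.List.Relation.Unary.All as LAll
open import Data.List.Relation.Unary.AllPairs using ([]; _∷_)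
import Data.List.Relation.Unary.Any as LAny
open import Data.List.Relation.Unary.Any using (here; there)
open import Data.List.Relation.Unary.Unique.Propositional using (Unique)
import Data.List.Relation.Unary.Unique.Propositional.Properties as Uniqueₚ
import Data.List.Relation.Unary.Unique.DecPropositional.Properties as DecUniqueₚ
open import Data.Maybe.Base using (Maybe; just; nothing)
import Data.Maybe.Properties as Maybeₚ
open import Data.Nat.Base as ℕ
  using (ℕ; zero; suc; _+_; _*_; _∸_; _^_; _⊔_; _≤_; _<_; z≤n; s≤s; NonZero; ⌊_/2⌋; ⌈_/2⌉)
open import Data.Nat.DivMod
  using (_/_; _%_; m/n*n≤m; m%n<n; m≡m%n+[m/n]*n; m<n*o⇒m/o<n; /-monoˡ-≤)
open import Data.Nat.Logarithm using (⌊log₂⌋-mono-≤; ⌊log₂[2^n]⌋≡n)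
import Data.Nat.Properties as ℕₚ
open import Data.Nat.Solver using (module +-*-Solver)
open import Data.Product.Base using (Σ; ∃; _×_; _,_; proj₁; proj₂)
open import Data.Rational.Base as ℚ using (ℚ; 0ℚ; 1ℚ; ½; toℚᵘ)
import Data.Rational.Properties as ℚₚ
open import Data.Rational.Solver using () renaming (module +-*-Solver to ℚ-Solver)
open import Data.Rational.Unnormalised.Base as ℚᵘ using (mkℚᵘ)
import Data.Rational.Unnormalised.Properties as ℚᵘₚ
open import Data.Sum.Base using (_⊎_; inj₁; inj₂; [_,_]′)
open import Data.Unit.Base using (⊤; tt)
open import Data.Vec.Base as Vec using (Vec; []; _∷_; _++_; lookup; toList)
import Data.Vec.Functional as Vector
import Data.Vec.Functional.Properties as Vectorₚ
import Data.Vec.Properties as Vecₚ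
open import Data.Vec.Relation.Binary.Pointwise.Inductive as Pw using (Pointwise; []; _∷_)
open import Data.Vec.Relation.Unary.All as All using (All; []; _∷_)
import Data.Vec.Relation.Unary.All.Properties as Allₚ
open import Data.Vec.Relation.Unary.Any using (Any; here; there)
import Data.Vec.Relation.Unary.Any.Properties as Anyₚ
open import Function.Base using (_∘_; const)
open import Function.Bundles using (_⇔_; mk⇔; Equivalence)
open import Level using (0ℓ)
open import Relation.Binary.Definitions using (tri<; tri≈; tri>)
open import Relation.Binary.PropositionalEquality
open import Relation.Nullary using (¬_; Dec; yes; no; does; contradiction; ¬?)
open import Relation.Nullary.Decidable
  using (_×-dec_; _⊎-dec_; _→-dec_; map′; dec-true; dec-false; from-yes)
open import Relation.Unary using (Pred; Decidable)

-- Inequalities between rational and real numbers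

frac-mono : ∀ a b m n .{{_ : NonZero m}} .{{_ : NonZero n}} →
            a * n ≤ b * m → ℤ.+ a ℚ./ m ℚ.≤ ℤ.+ b ℚ./ n
frac-mono a b (suc m) (suc n) h = ℚₚ.toℚᵘ-cancel-≤ (begin
  toℚᵘ (ℤ.+ a ℚ./ suc m) ≃⟨ ℚₚ.toℚᵘ-fromℚᵘ (mkℚᵘ (ℤ.+ a) m) ⟩
  mkℚᵘ (ℤ.+ a) m         ≤⟨ ℚᵘ.*≤* (subst₂ ℤ._≤_ (ℤₚ.pos-* a (suc n)) (ℤₚ.pos-* b (suc m)) (ℤ.+≤+ h)) ⟩
  mkℚᵘ (ℤ.+ b) n         ≃⟨ ℚₚ.toℚᵘ-fromℚᵘ (mkℚᵘ (ℤ.+ b) n) ⟨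
  toℚᵘ (ℤ.+ b ℚ./ suc n) ∎)
  where open ℚᵘₚ.≤-Reasoning

frac-cancel : ∀ a b m n .{{_ : NonZero m}} .{{_ : NonZero n}} →
              ℤ.+ a ℚ./ m ℚ.≤ ℤ.+ b ℚ./ n → a * n ≤ b * m
frac-cancel a b (suc m) (suc n) h
  with subst₂ ℤ._≤_ (sym (ℤₚ.pos-* a (suc n))) (sym (ℤₚ.pos-* b (suc m)))
         (ℚᵘₚ.drop-*≤* le)
  where
  open ℚᵘₚ.≤-Reasoning
  le : mkℚᵘ (ℤ.+ a) m ℚᵘ.≤ mkℚᵘ (ℤ.+ b) n
  le = begin
    mkℚᵘ (ℤ.+ a) m         ≃⟨ ℚₚ.toℚᵘ-fromℚᵘ (mkℚᵘ (ℤ.+ a) m) ⟨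
    toℚᵘ (ℤ.+ a ℚ./ suc m) ≤⟨ ℚₚ.toℚᵘ-mono-≤ h ⟩
    toℚᵘ (ℤ.+ b ℚ./ suc n) ≃⟨ ℚₚ.toℚᵘ-fromℚᵘ (mkℚᵘ (ℤ.+ b) n) ⟩
    mkℚᵘ (ℤ.+ b) n         ∎
... | ℤ.+≤+ le = le

frac-+ : ∀ a b n .{{_ : NonZero n}} → ℤ.+ a ℚ./ n ℚ.+ ℤ.+ b ℚ./ n ≡ ℤ.+ (a + b) ℚ./ n
frac-+ a b (suc n) = ℚₚ.toℚᵘ-injective (begin
  toℚᵘ (ℤ.+ a ℚ./ suc n ℚ.+ ℤ.+ b ℚ./ suc n)           ≈⟨ ℚₚ.toℚᵘ-homo-+ (ℤ.+ a ℚ./ suc n) (ℤ.+ b ℚ./ suc n) ⟩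
  toℚᵘ (ℤ.+ a ℚ./ suc n) ℚᵘ.+ toℚᵘ (ℤ.+ b ℚ./ suc n)   ≈⟨ ℚᵘₚ.+-cong (ℚₚ.toℚᵘ-fromℚᵘ (mkℚᵘ (ℤ.+ a) n))
                                                                  (ℚₚ.toℚᵘ-fromℚᵘ (mkℚᵘ (ℤ.+ b) n)) ⟩
  mkℚᵘ (ℤ.+ a) n ℚᵘ.+ mkℚᵘ (ℤ.+ b) n                   ≈⟨ ℚᵘ.*≡* eq ⟩
  mkℚᵘ (ℤ.+ (a + b)) n                                 ≈⟨ ℚₚ.toℚᵘ-fromℚᵘ (mkℚᵘ (ℤ.+ (a + b)) n) ⟨
  toℚᵘ (ℤ.+ (a + b) ℚ./ suc n)                         ∎)
  where
  open import Relation.Binary.Reasoning.Setoid ℚᵘₚ.≃-setoid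
  eq : (ℤ.+ a ℤ.* ℤ.+ suc n ℤ.+ ℤ.+ b ℤ.* ℤ.+ suc n) ℤ.* ℤ.+ suc n ≡ ℤ.+ (a + b) ℤ.* ℤ.+ (suc n * suc n)
  eq = trans (cong (ℤ._* ℤ.+ suc n) (sym (ℤₚ.*-distribʳ-+ (ℤ.+ suc n) (ℤ.+ a) (ℤ.+ b))))
      (trans (ℤₚ.*-assoc (ℤ.+ (a + b)) (ℤ.+ suc n) (ℤ.+ suc n))
             (cong (ℤ.+ (a + b) ℤ.*_) (sym (ℤₚ.pos-* (suc n) (suc n)))))

frac-* : ∀ a b m n .{{_ : NonZero m}} .{{_ : NonZero n}} →
         (ℤ.+ a ℚ./ m) ℚ.* (ℤ.+ b ℚ./ n) ≡ (ℤ.+ (a * b) ℚ./ (m * n)) {{ℕₚ.m*n≢0 m n}}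
frac-* a b (suc m) (suc n) = ℚₚ.toℚᵘ-injective (begin
  toℚᵘ ((ℤ.+ a ℚ./ suc m) ℚ.* (ℤ.+ b ℚ./ suc n))       ≈⟨ ℚₚ.toℚᵘ-homo-* (ℤ.+ a ℚ./ suc m) (ℤ.+ b ℚ./ suc n) ⟩
  toℚᵘ (ℤ.+ a ℚ./ suc m) ℚᵘ.* toℚᵘ (ℤ.+ b ℚ./ suc n)   ≈⟨ ℚᵘₚ.*-cong (ℚₚ.toℚᵘ-fromℚᵘ (mkℚᵘ (ℤ.+ a) m))
                                                                (ℚₚ.toℚᵘ-fromℚᵘ (mkℚᵘ (ℤ.+ b) n)) ⟩
  mkℚᵘ (ℤ.+ a) m ℚᵘ.* mkℚᵘ (ℤ.+ b) n                   ≈⟨ ℚᵘ.*≡* (cong (ℤ._* ℤ.+ (suc m * suc n)) (sym (ℤₚ.pos-* a b))) ⟩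
  mkℚᵘ (ℤ.+ (a * b)) (n + m * suc n)                   ≈⟨ ℚₚ.toℚᵘ-fromℚᵘ (mkℚᵘ (ℤ.+ (a * b)) (n + m * suc n)) ⟨
  toℚᵘ (ℤ.+ (a * b) ℚ./ (suc m * suc n))               ∎)
  where open import Relation.Binary.Reasoning.Setoid ℚᵘₚ.≃-setoid

≤-+ε : ∀ {p q ε} → p ℚ.≤ q → 0ℚ ℚ.< ε → p ℚ.≤ q ℚ.+ ε
≤-+ε {q = q} {ε} p≤q 0<ε = ℚₚ.≤-trans p≤q
  (subst (ℚ._≤ q ℚ.+ ε) (ℚₚ.+-identityʳ q) (ℚₚ.+-monoʳ-≤ q (ℚₚ.<⇒≤ 0<ε)))

pointwise-≤ᴿ : ∀ x y → (∀ i → seq x i ℚ.≤ seq y i) → x ≤ᴿ y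
pointwise-≤ᴿ x y h ε 0<ε = 0 , λ i _ → ≤-+ε (h i) 0<ε

-- If `q < p`, a rational `r` strictly between them gives the tolerance `r - q`, for which the
-- hypothesis yields `p ≤ r`.
fromℚ-cancel : ∀ {p q} → fromℚ p ≤ᴿ fromℚ q → p ℚ.≤ q
fromℚ-cancel {p} {q} h = ℚₚ.≮⇒≥ λ q<p →
  let r , q<r , r<p = ℚₚ.<-dense q<p
      0<r-q = subst (ℚ._< r ℚ.- q) (ℚₚ.+-inverseʳ q) (ℚₚ.+-monoˡ-< (ℚ.- q) q<r)
      N , le = h (r ℚ.- q) 0<r-q
  in ℚₚ.<-irrefl refl (ℚₚ.<-≤-trans r<p (subst (p ℚ.≤_)
       (solve 2 (λ q r → q :+ (r :- q) := r) refl q r) (le N ℕₚ.≤-refl)))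
  where open ℚ-Solver

≤ᴿ-trans : ∀ x y z → x ≤ᴿ y → y ≤ᴿ z → x ≤ᴿ z
≤ᴿ-trans x y z x≤y y≤z ε 0<ε =
  let δ = ½ ℚ.* ε
      0<δ = subst (ℚ._< δ) (ℚₚ.*-zeroʳ ½) (ℚₚ.*-monoʳ-<-pos ½ 0<ε)
      M , hM = x≤y δ 0<δ
      N , hN = y≤z δ 0<δ
      δ+δ≡ε = trans (sym (ℚₚ.*-distribʳ-+ ε ½ ½)) (ℚₚ.*-identityˡ ε)
  in M ℕ.⊔ N , λ i ≤i → ℚₚ.≤-trans (hM i (ℕₚ.m⊔n≤o⇒m≤o M N ≤i))
       (subst (seq y i ℚ.+ δ ℚ.≤_)
         (trans (ℚₚ.+-assoc (seq z i) δ δ) (cong (seq z i ℚ.+_) δ+δ≡ε))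
         (ℚₚ.+-monoˡ-≤ δ (hN i (ℕₚ.m⊔n≤o⇒n≤o M N ≤i))))

fromℕ-≤ : ∀ {a b} → a ≤ b → ℤ.+ a ℚ./ 1 ℚ.≤ ℤ.+ b ℚ./ 1
fromℕ-≤ {a} {b} a≤b = frac-mono a b 1 1 (ℕₚ.*-monoˡ-≤ 1 a≤b)

-- The bound holds for every term of the sequence of `log₂ d`, not only in the limit, so the real
-- inequalities below can be proved term by term.
log-term-≥ : ∀ d l i → 2 ^ l ≤ d → ℤ.+ l ℚ./ 1 ℚ.≤ ℤ.+ log-term d i ℚ./ suc i
log-term-≥ d l i 2^l≤d = frac-mono l (log-term d i) 1 (suc i)
  (subst (l * suc i ≤_) (sym (ℕₚ.*-identityʳ (log-term d i)))
    (subst (_≤ log-term d i) (⌊log₂[2^n]⌋≡n (l * suc i))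
      (⌊log₂⌋-mono-≤ (subst (_≤ d ^ suc i) (ℕₚ.^-*-assoc 2 l (suc i)) (ℕₚ.^-monoˡ-≤ (suc i) 2^l≤d)))))

2^l≤d<2^[1+l] : ∀ d .{{_ : NonZero d}} → ∃ λ l → 2 ^ l ≤ d × d < 2 ^ suc l
2^l≤d<2^[1+l] 1 = 0 , s≤s z≤n , s≤s (s≤s z≤n)
2^l≤d<2^[1+l] (suc d@(suc _)) with 2^l≤d<2^[1+l] d
... | l , lo , hi with suc d ℕₚ.<? 2 ^ suc l
...   | yes d< = l , ℕₚ.m≤n⇒m≤1+n lo , d<
...   | no  d≮ = suc l , ℕₚ.≮⇒≥ d≮ ,
        ℕₚ.≤-<-trans hi (ℕₚ.^-monoʳ-< 2 (s≤s (s≤s z≤n)) (ℕₚ.n<1+n (suc l)))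

-- Every term of log₂ d + 3 is at least l + 3 ≥ 2h.
lower-bound : ∀ d l h w T N .{{_ : NonZero d}} → 2 ^ l ≤ d → h * 2 ≤ l + 3 → d ≤ w * h →
              T * w ≤ 2 * N →
              fromℕ T *ᴿ (fromℕ d ÷ᴿ (log₂ d +ᴿ fromℕ 3) ⟨ 0<log₂n+3 d ⟩) ≤ᴿ fromℕ N
lower-bound d l h w T N 2^l≤d 2h≤ d≤wh Tw≤2N = pointwise-≤ᴿ
  (fromℕ T *ᴿ (fromℕ d ÷ᴿ (log₂ d +ᴿ fromℕ 3) ⟨ 0<log₂n+3 d ⟩)) (fromℕ N) λ i →
  -- Term `i` of the reciprocal is the inverse of the maximum of 3, the witness in `0<log₂n+3`, and
  -- term `i` of the denominator; this maximum takes the place of `z`.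
  main _ (ℚₚ.<-≤-trans (ℚₚ.positive⁻¹ (ℤ.+ 3 ℚ./ 1)) (ℚₚ.p≤p⊔q (ℤ.+ 3 ℚ./ 1) (seq (log₂ d +ᴿ fromℕ 3) i)))
         (ℚₚ.≤-trans (l+3≤ i) (ℚₚ.p≤q⊔p (ℤ.+ 3 ℚ./ 1) _))
  where
  l+3≤ : ∀ i → ℤ.+ (l + 3) ℚ./ 1 ℚ.≤ seq (log₂ d +ᴿ fromℕ 3) i
  l+3≤ i = subst (ℚ._≤ seq (log₂ d +ᴿ fromℕ 3) i) (frac-+ l 3 1)
             (ℚₚ.+-monoˡ-≤ (ℤ.+ 3 ℚ./ 1) (log-term-≥ d l i 2^l≤d))
  Td≤N[l+3] : T * d ≤ N * (l + 3)
  Td≤N[l+3] = begin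
    T * d         ≤⟨ ℕₚ.*-monoʳ-≤ T d≤wh ⟩
    T * (w * h)   ≡⟨ ℕₚ.*-assoc T w h ⟨
    T * w * h     ≤⟨ ℕₚ.*-monoˡ-≤ h Tw≤2N ⟩
    2 * N * h     ≡⟨ cong (_* h) (ℕₚ.*-comm 2 N) ⟩
    N * 2 * h     ≡⟨ ℕₚ.*-assoc N 2 h ⟩
    N * (2 * h)   ≡⟨ cong (N *_) (ℕₚ.*-comm 2 h) ⟩
    N * (h * 2)   ≤⟨ ℕₚ.*-monoʳ-≤ N 2h≤ ⟩
    N * (l + 3)   ∎
    where open ℕₚ.≤-Reasoning
  main : ∀ z (0<z : 0ℚ ℚ.< z) → ℤ.+ (l + 3) ℚ./ 1 ℚ.≤ z →
         (ℤ.+ T ℚ./ 1) ℚ.* ((ℤ.+ d ℚ./ 1) ℚ.* (ℚ.1/ z) {{ℚ.>-nonZero 0<z}}) ℚ.≤ ℤ.+ N ℚ./ 1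
  main z 0<z l+3≤z = ℚₚ.*-cancelʳ-≤-pos z {{ℚ.positive 0<z}} (begin
    (ℤ.+ T ℚ./ 1) ℚ.* ((ℤ.+ d ℚ./ 1) ℚ.* (ℚ.1/ z)) ℚ.* z
      ≡⟨ solve 4 (λ a b c e → a :* (b :* c) :* e := (a :* b) :* (c :* e)) refl
           (ℤ.+ T ℚ./ 1) (ℤ.+ d ℚ./ 1) (ℚ.1/ z) z ⟩
    (ℤ.+ T ℚ./ 1) ℚ.* (ℤ.+ d ℚ./ 1) ℚ.* ((ℚ.1/ z) ℚ.* z)
      ≡⟨ cong₂ ℚ._*_ (frac-* T d 1 1) (ℚₚ.*-inverseˡ z) ⟩
    (ℤ.+ (T * d) ℚ./ 1) ℚ.* 1ℚ
      ≡⟨ ℚₚ.*-identityʳ _ ⟩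
    ℤ.+ (T * d) ℚ./ 1
      ≤⟨ fromℕ-≤ Td≤N[l+3] ⟩
    ℤ.+ (N * (l + 3)) ℚ./ 1
      ≡⟨ frac-* N (l + 3) 1 1 ⟨
    (ℤ.+ N ℚ./ 1) ℚ.* (ℤ.+ (l + 3) ℚ./ 1)
      ≤⟨ ℚₚ.*-monoˡ-≤-nonNeg (ℤ.+ N ℚ./ 1) {{ℚₚ.normalize-nonNeg N 1}} l+3≤z ⟩
    (ℤ.+ N ℚ./ 1) ℚ.* z ∎)
    where open ℚₚ.≤-Reasoning
          open ℚ-Solver
          instance z≢0 = ℚ.>-nonZero 0<z

-- Both roundings go in the right direction: `d / k` is integer division, and `l` is at most each
-- term of `log₂ d`.
upper-bound : ∀ d k m l N .{{_ : NonZero d}} .{{_ : NonZero k}} → 2 ^ l ≤ d →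
              N ≤ m * (d / k + (l + 3)) →
              fromℕ N ≤ᴿ fromℕ m *ᴿ (fromℚ (ℤ.+ d ℚ./ k) +ᴿ log₂ d +ᴿ fromℕ 3)
upper-bound d k m l N 2^l≤d N≤ = pointwise-≤ᴿ
  (fromℕ N) (fromℕ m *ᴿ (fromℚ (ℤ.+ d ℚ./ k) +ᴿ log₂ d +ᴿ fromℕ 3)) λ i → begin
  ℤ.+ N ℚ./ 1
    ≤⟨ fromℕ-≤ N≤ ⟩
  ℤ.+ (m * (d / k + (l + 3))) ℚ./ 1
    ≡⟨ frac-* m (d / k + (l + 3)) 1 1 ⟨
  (ℤ.+ m ℚ./ 1) ℚ.* (ℤ.+ (d / k + (l + 3)) ℚ./ 1)
    ≤⟨ ℚₚ.*-monoˡ-≤-nonNeg (ℤ.+ m ℚ./ 1) {{ℚₚ.normalize-nonNeg m 1}} (inner i) ⟩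
  seq (fromℕ m *ᴿ (fromℚ (ℤ.+ d ℚ./ k) +ᴿ log₂ d +ᴿ fromℕ 3)) i ∎
  where
  open ℚₚ.≤-Reasoning
  inner : ∀ i → ℤ.+ (d / k + (l + 3)) ℚ./ 1 ℚ.≤ ℤ.+ d ℚ./ k ℚ.+ ℤ.+ log-term d i ℚ./ suc i ℚ.+ ℤ.+ 3 ℚ./ 1
  inner i = begin
    ℤ.+ (d / k + (l + 3)) ℚ./ 1
      ≡⟨ cong (λ n → ℤ.+ n ℚ./ 1) (ℕₚ.+-assoc (d / k) l 3) ⟨
    ℤ.+ (d / k + l + 3) ℚ./ 1
      ≡⟨ frac-+ (d / k + l) 3 1 ⟨
    ℤ.+ (d / k + l) ℚ./ 1 ℚ.+ ℤ.+ 3 ℚ./ 1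
      ≡⟨ cong (ℚ._+ ℤ.+ 3 ℚ./ 1) (frac-+ (d / k) l 1) ⟨
    ℤ.+ (d / k) ℚ./ 1 ℚ.+ ℤ.+ l ℚ./ 1 ℚ.+ ℤ.+ 3 ℚ./ 1
      ≤⟨ ℚₚ.+-monoˡ-≤ (ℤ.+ 3 ℚ./ 1) (ℚₚ.+-mono-≤
           (frac-mono (d / k) d 1 k (subst (d / k * k ≤_) (sym (ℕₚ.*-identityʳ d)) (m/n*n≤m d k)))
           (log-term-≥ d l i 2^l≤d)) ⟩
    ℤ.+ d ℚ./ k ℚ.+ ℤ.+ log-term d i ℚ./ suc i ℚ.+ ℤ.+ 3 ℚ./ 1 ∎

-- Counting in lists, and small subsets avoiding a list

length-filter-¬ : ∀ {X : Set} {P : Pred X 0ℓ} (P? : Decidable P) xs →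
                  length (filter P? xs) + length (filter (¬? ∘ P?) xs) ≡ length xs
length-filter-¬ P? []       = refl
length-filter-¬ P? (x ∷ xs) with does (P? x)
... | true  = cong suc (length-filter-¬ P? xs)
... | false = trans (ℕₚ.+-suc _ _) (cong suc (length-filter-¬ P? xs))

occurrences : ℕ → List ℕ → ℕ
occurrences γ xs = length (filter (ℕₚ._≟ γ) xs)

occurrences-filter : ∀ γ {P : Pred ℕ 0ℓ} (P? : Decidable P) xs →
                     occurrences γ (filter P? xs) ≤ occurrences γ xs
occurrences-filter γ P? []       = z≤n
occurrences-filter γ P? (x ∷ xs) with does (P? x)
... | true  with does (x ℕₚ.≟ γ)
...   | true  = s≤s (occurrences-filter γ P? xs)
...   | false = occurrences-filter γ P? xs
occurrences-filter γ P? (x ∷ xs) | false with does (x ℕₚ.≟ γ)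
...   | true  = ℕₚ.m≤n⇒m≤1+n (occurrences-filter γ P? xs)
...   | false = occurrences-filter γ P? xs

-- Pigeonhole: dropping `y` from `ys` costs `xs` at most `h` elements.
length≤occurrences : ∀ h ys xs → (∀ {x} → x L.∈ xs → x L.∈ ys) →
                     (∀ γ → occurrences γ xs ≤ h) → length xs ≤ length ys * h
length≤occurrences h []       []       sub occ = z≤n
length≤occurrences h []       (x ∷ xs) sub occ with () ← sub (here refl)
length≤occurrences h (y ∷ ys) xs       sub occ = subst (_≤ h + length ys * h)
  (length-filter-¬ (ℕₚ._≟ y) xs)
  (ℕₚ.+-mono-≤ (occ y) (length≤occurrences h ys (filter ≢y? xs) sub′
    λ γ → ℕₚ.≤-trans (occurrences-filter γ ≢y? xs) (occ γ)))
  where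
  ≢y? : Decidable (λ x → ¬ x ≡ y)
  ≢y? x = ¬? (x ℕₚ.≟ y)
  sub′ : ∀ {x} → x L.∈ filter ≢y? xs → x L.∈ ys
  sub′ x∈ with x∈xs , x≢y ← Lₚ.∈-filter⁻ ≢y? {xs = xs} x∈ with sub x∈xs
  ... | here x≡y   = contradiction x≡y x≢y
  ... | there x∈ys = x∈ys

unique-⊆⇒length-≤ : ∀ {xs} ys → Unique xs → (∀ {x} → x L.∈ xs → x L.∈ ys) → length xs ≤ length ys
unique-⊆⇒length-≤ {[]}     ys _             _   = z≤n
unique-⊆⇒length-≤ {x ∷ xs} ys (x∉xs ∷ uniq) sub = ℕₚ.≤-<-trans
  (unique-⊆⇒length-≤ (filter ≢x? ys) uniq
    λ y∈xs → Lₚ.∈-filter⁺ ≢x? (sub (there y∈xs)) (LAll.lookup x∉xs y∈xs ∘ sym))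
  (Listₚ.filter-notAll ≢x? ys (LAny.map (λ { refl ≢ → ≢ refl }) (sub (here refl))))
  where
  ≢x? : Decidable (λ y → ¬ y ≡ x)
  ≢x? y = ¬? (y ℕₚ.≟ x)

private
  tails-in tails-out : ∀ {n} → List (Subset (suc n)) → List (Subset n)
  tails-in []                   = []
  tails-in ((inside  ∷ S) ∷ xs) = S ∷ tails-in xs
  tails-in ((outside ∷ S) ∷ xs) = tails-in xs
  tails-out []                   = []
  tails-out ((inside  ∷ S) ∷ xs) = tails-out xs
  tails-out ((outside ∷ S) ∷ xs) = S ∷ tails-out xs

  length-tails : ∀ {n} (xs : List (Subset (suc n))) →
                 length (tails-in xs) + length (tails-out xs) ≡ length xs
  length-tails []                   = refl
  length-tails ((inside  ∷ S) ∷ xs) = cong suc (length-tails xs)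
  length-tails ((outside ∷ S) ∷ xs) = trans (ℕₚ.+-suc _ _) (cong suc (length-tails xs))

  ∈-tails-in : ∀ {n S} {xs : List (Subset (suc n))} → inside ∷ S L.∈ xs → S L.∈ tails-in xs
  ∈-tails-in {xs = (inside  ∷ _) ∷ _} (here refl) = here refl
  ∈-tails-in {xs = (inside  ∷ _) ∷ _} (there p)   = there (∈-tails-in p)
  ∈-tails-in {xs = (outside ∷ _) ∷ _} (there p)   = ∈-tails-in p

  ∈-tails-out : ∀ {n S} {xs : List (Subset (suc n))} → outside ∷ S L.∈ xs → S L.∈ tails-out xs
  ∈-tails-out {xs = (outside ∷ _) ∷ _} (here refl) = here refl
  ∈-tails-out {xs = (outside ∷ _) ∷ _} (there p)   = there (∈-tails-out p)
  ∈-tails-out {xs = (inside  ∷ _) ∷ _} (there p)   = ∈-tails-out p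

-- The list is split by whether the first point is inside. Fewer than `2 ^ suc n` subsets cannot
-- leave both halves with `2 ^ n` or more.
fresh-subset : ∀ n (xs : List (Subset n)) → length xs < 2 ^ n → ∃ λ S → ¬ S L.∈ xs
fresh-subset zero    []       h = [] , λ ()
fresh-subset zero    (_ ∷ _)  (s≤s ())
fresh-subset (suc n) xs h with length (tails-in xs) ℕₚ.<? 2 ^ n
... | yes p = let S , S∉ = fresh-subset n (tails-in xs) p in inside ∷ S , S∉ ∘ ∈-tails-in
... | no ¬p = let S , S∉ = fresh-subset n (tails-out xs) q in outside ∷ S , S∉ ∘ ∈-tails-out
  where
  q : length (tails-out xs) < 2 ^ n
  q = ℕₚ.+-cancelˡ-< (2 ^ n) _ _ (begin-strict
    2 ^ n + length (tails-out xs)                ≤⟨ ℕₚ.+-monoˡ-≤ _ (ℕₚ.≮⇒≥ ¬p) ⟩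
    length (tails-in xs) + length (tails-out xs) ≡⟨ length-tails xs ⟩
    length xs                                    <⟨ h ⟩
    2 ^ n + (2 ^ n + 0)                          ≡⟨ cong (2 ^ n +_) (ℕₚ.+-identityʳ _) ⟩
    2 ^ n + 2 ^ n                                ∎)
    where open ℕₚ.≤-Reasoning

-- Of two complementary subsets one has at most h elements.
fresh-small-subset : ∀ n h (xs : List (Subset (suc n))) → n ≤ h + h → length xs < 2 ^ n →
                     ∃ λ S → card S ≤ h × ¬ S L.∈ xs
fresh-small-subset n h xs n≤2h len
  with fresh-subset n (List.map half xs) (subst (_< 2 ^ n) (sym (Listₚ.length-map half xs)) len)
  where
  -- A subset and its complement have the same `half`, so an `S` that is no `half` makes both
  -- `outside ∷ S` and its complement fresh.
  half : Subset (suc n) → Subset n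
  half (outside ∷ S) = S
  half (inside  ∷ S) = ∁ S
... | S , S∉ with card S ℕₚ.≤? h
...   | yes ∣S∣≤h = outside ∷ S , ∣S∣≤h , λ ∈xs → S∉ (Lₚ.∈-map⁺ _ ∈xs)
...   | no  ∣S∣≰h = inside ∷ ∁ S , ∣∁S∣<h , λ ∈xs → S∉ (subst (L._∈ _) ∁∁S≡S (Lₚ.∈-map⁺ _ ∈xs))
  where
  ∁∁S≡S : ∁ (∁ S) ≡ S
  ∁∁S≡S = trans (sym (Vecₚ.map-∘ not not S)) (trans (Vecₚ.map-cong Boolₚ.not-involutive S) (Vecₚ.map-id S))
  ∣∁S∣<h : suc (card (∁ S)) ≤ h
  ∣∁S∣<h = begin
    suc (card (∁ S))    ≡⟨ cong suc (∣∁p∣≡n∸∣p∣ S) ⟩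
    suc (n ∸ card S)    ≤⟨ s≤s (ℕₚ.∸-mono n≤2h (ℕₚ.≰⇒> ∣S∣≰h)) ⟩
    -- With truncated subtraction this needs `h` positive; for `h` zero, `S` would be empty and thus
    -- already small.
    suc (h + h ∸ suc h) ≡⟨ ℕₚ.+-∸-assoc 1 (ℕₚ.m<m+n h (ℕₚ.n≢0⇒n>0 h≢0)) ⟨
    h + h ∸ h           ≡⟨ ℕₚ.m+n∸n≡m h h ⟩
    h                   ∎
    where
    open ℕₚ.≤-Reasoning
    h≢0 : ¬ h ≡ 0
    h≢0 h≡0 = ∣S∣≰h (ℕₚ.≤-trans (∣p∣≤n S) (ℕₚ.≤-trans n≤2h (ℕₚ.≤-reflexive (cong (_+ h) h≡0))))

-- Conditional sums over vectors

infix 3 _when_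

_when_ : ∀ {P : Set} → ℕ → Dec P → ℕ
v when P? = if does P? then v else 0

when-≤ : ∀ {P : Set} v (P? : Dec P) → (v when P?) ≤ v
when-≤ v (yes _) = ℕₚ.≤-refl
when-≤ v (no  _) = z≤n

when-mono : ∀ {P Q : Set} v (P? : Dec P) (Q? : Dec Q) → (P → Q) → (v when P?) ≤ (v when Q?)
when-mono v (no  _) _       _   = z≤n
when-mono v (yes _) (yes _) _   = ℕₚ.≤-refl
when-mono v (yes p) (no ¬q) P⇒Q = contradiction (P⇒Q p) ¬q

when-disjoint : ∀ {P Q R : Set} v (P? : Dec P) (Q? : Dec Q) (R? : Dec R) →
                (P → R) → (Q → R) → (P → ¬ Q) → (v when P?) + (v when Q?) ≤ (v when R?)
when-disjoint v (yes p) (yes q) _  P⇒R Q⇒R P⇒¬Q = contradiction q (P⇒¬Q p)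
when-disjoint v (yes p) (no ¬q) R? P⇒R Q⇒R P⇒¬Q =
  subst (_≤ (v when R?)) (sym (ℕₚ.+-identityʳ v)) (when-mono v (yes p) R? P⇒R)
when-disjoint v (no ¬p) Q?      R? P⇒R Q⇒R P⇒¬Q = when-mono v Q? R? Q⇒R

when-when : ∀ {P Q : Set} v (P? : Dec P) (Q? : Dec Q) → (P → Q) →
            (v when P?) ≤ ((v when P?) when Q?)
when-when v P?      (yes _) _   = ℕₚ.≤-refl
when-when v (no _)  (no _)  _   = z≤n
when-when v (yes p) (no ¬q) P⇒Q = contradiction (P⇒Q p) ¬q

total : ∀ {X : Set} {n} → (X → ℕ) → Vec X n → ℕ
total v []       = 0
total v (x ∷ xs) = v x + total v xs

total₂ : ∀ {X Y : Set} {n} → (X → Y → ℕ) → Vec X n → Vec Y n → ℕ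
total₂ v []       []       = 0
total₂ v (x ∷ xs) (y ∷ ys) = v x y + total₂ v xs ys

total-+-≤ : ∀ {X : Set} {n} {u v w : X → ℕ} → (∀ x → u x + v x ≤ w x) →
            (xs : Vec X n) → total u xs + total v xs ≤ total w xs
total-+-≤ h []       = z≤n
total-+-≤ {u = u} {v} {w} h (x ∷ xs) = begin
  u x + total u xs + (v x + total v xs) ≡⟨ interchange (u x) (total u xs) (v x) (total v xs) ⟩
  u x + v x + (total u xs + total v xs) ≤⟨ ℕₚ.+-mono-≤ (h x) (total-+-≤ h xs) ⟩
  w x + total w xs                      ∎
  where
  open ℕₚ.≤-Reasoning
  open import Algebra.Properties.CommutativeSemigroup ℕₚ.+-commutativeSemigroup using (interchange)

total-1 : ∀ {X : Set} {n} (xs : Vec X n) → total (const 1) xs ≡ n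
total-1 []       = refl
total-1 (_ ∷ xs) = cong suc (total-1 xs)

total₂-++ : ∀ {X Y : Set} {m n} (v : X → Y → ℕ) (xs : Vec X m) {xs′ : Vec X n} ys {ys′} →
            total₂ v (xs Vec.++ xs′) (ys Vec.++ ys′) ≡ total₂ v xs ys + total₂ v xs′ ys′
total₂-++ v []       []       = refl
total₂-++ v (x ∷ xs) (y ∷ ys) =
  trans (cong (v x y +_) (total₂-++ v xs ys)) (sym (ℕₚ.+-assoc (v x y) _ _))

total₂-mono : ∀ {X Y : Set} {n} {u v : X → Y → ℕ} {xs : Vec X n} {ys : Vec Y n} →
              Pointwise (λ x y → u x y ≤ v x y) xs ys → total₂ u xs ys ≤ total₂ v xs ys
total₂-mono []       = z≤n
total₂-mono (p ∷ ps) = ℕₚ.+-mono-≤ p (total₂-mono ps)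

total₂-0 : ∀ {X Y : Set} {n} {v : X → Y → ℕ} {xs : Vec X n} {ys : Vec Y n} →
           Pointwise (λ x y → v x y ≡ 0) xs ys → total₂ v xs ys ≡ 0
total₂-0 []       = refl
total₂-0 (p ∷ ps) = cong₂ _+_ p (total₂-0 ps)

-- Splitting the hue classes into parts of at most k elements: sort by hue and
-- let an element of hue h in position t have class ⌊t / k⌋ + h. Both summands
-- are monotone in t, so equal classes have equal hues and equal ⌊t / k⌋.

module Refinement {c′ : ℕ} (k : ℕ) .{{_ : NonZero k}} where

  c : ℕ
  c = suc c′

  count below : ∀ {n} → Fin c → Vec (Fin c) n → ℕ
  count f = total (λ f′ → 1 when f′ Finₚ.≟ f)
  below f = total (λ f′ → 1 when f′ Finₚ.<? f)

  class : (Fin c → ℕ) → Fin c → ℕ → ℕ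
  class b f r = (b f + r) / k + toℕ f

  -- The rank of an element within its hue is the number of elements of that hue further down the
  -- vector.
  classes : ∀ {n} → (Fin c → ℕ) → Vec (Fin c) n → Vec ℕ n
  classes b []       = []
  classes b (f ∷ fs) = class b f (count f fs) ∷ classes b fs

  -- `b` and `cap` remain those of the whole vector while the induction runs over its tails; hence
  -- they are parameters here.
  module _ (b cap : Fin c → ℕ) (N : ℕ)
           (b+cap≤b : ∀ {f f′} → f Fin.< f′ → b f + cap f ≤ b f′)
           (b+cap≤N : ∀ f → b f + cap f ≤ N) where

    HasRank : Fin c → ℕ → Set
    HasRank f ℓ = ∃ λ r → r < cap f × ℓ ≡ class b f r

    class-< : ∀ {f f′ r r′} → f Fin.< f′ → r < cap f → class b f r < class b f′ r′
    class-< {f} {f′} {r} {r′} f<f′ r< = ℕₚ.+-mono-≤-< (/-monoˡ-≤ k (begin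
      b f + r      ≤⟨ ℕₚ.+-monoʳ-≤ (b f) (ℕₚ.<⇒≤ r<) ⟩
      b f + cap f  ≤⟨ b+cap≤b f<f′ ⟩
      b f′         ≤⟨ ℕₚ.m≤m+n (b f′) r′ ⟩
      b f′ + r′    ∎)) f<f′
      where open ℕₚ.≤-Reasoning

    hue-unique : ∀ {f f′ ℓ} → HasRank f ℓ → HasRank f′ ℓ → f ≡ f′
    hue-unique {f} {f′} (r , r< , eq) (r′ , r′< , eq′) with Finₚ.<-cmp f f′
    ... | tri< f<f′ _ _ = contradiction (trans (sym eq) eq′) (ℕₚ.<⇒≢ (class-< f<f′ r<))
    ... | tri≈ _ f≡f′ _ = f≡f′
    ... | tri> _ _ f>f′ = contradiction (trans (sym eq′) eq) (ℕₚ.<⇒≢ (class-< f>f′ r′<))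

    HasRank⇒< : ∀ {f ℓ} → HasRank f ℓ → ℓ < N / k + c
    HasRank⇒< {f} (r , r< , refl) = ℕₚ.+-mono-≤-<
      (/-monoˡ-≤ k (ℕₚ.≤-trans (ℕₚ.+-monoʳ-≤ (b f) (ℕₚ.<⇒≤ r<)) (b+cap≤N f))) (Finₚ.toℕ<n f)

    classes-HasRank : ∀ {n} (fs : Vec (Fin c) n) → (∀ f → count f fs ≤ cap f) →
                      Pointwise HasRank fs (classes b fs)
    classes-HasRank []       h = []
    classes-HasRank (f ∷ fs) h =
      (count f fs , subst (_≤ cap f) count-head (h f) , refl) ∷
      classes-HasRank fs λ f′ → ℕₚ.≤-trans (ℕₚ.m≤n+m _ (1 when f Finₚ.≟ f′)) (h f′)
      where
      count-head : count f (f ∷ fs) ≡ suc (count f fs)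
      count-head with f Finₚ.≟ f
      ... | yes _  = refl
      ... | no f≢f = contradiction refl f≢f

    monochromatic : ∀ {n} {fs : Vec (Fin c) n} {ℓs : Vec ℕ n} → Pointwise HasRank fs ℓs →
                    ∀ κ → ∃ λ f → Pointwise (λ f′ ℓ → ℓ ≡ κ → f′ ≡ f) fs ℓs
    -- An empty class may be given any hue.
    monochromatic [] κ = zero , []
    monochromatic (_∷_ {x = f} {y = ℓ} p ps) κ with ℓ ℕₚ.≟ κ
    ... | yes refl = f , (λ _ → refl) ∷ Pw.map (λ { q refl → hue-unique q p }) ps
    ... | no  ℓ≢κ  = let f′ , qs = monochromatic ps κ in f′ , (λ ℓ≡κ → contradiction ℓ≡κ ℓ≢κ) ∷ qs

  members : ∀ {n} → Fin c → ℕ → Vec (Fin c) n → Vec ℕ n → ℕ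
  members f κ = total₂ (λ f′ ℓ → (1 when ℓ ℕₚ.≟ κ) when f′ Finₚ.≟ f)

  module _ (b : Fin c → ℕ) (f : Fin c) (κ : ℕ) where

    private
      q = κ ∸ toℕ f

    -- The members have positions in the block of length `k` that starts at `q * k`, and positions
    -- within a hue are consecutive. The second bound counts how far the positions assigned so far
    -- have passed `q * k`; when a member is added, it yields the first.
    members-≤ : ∀ {n} (fs : Vec (Fin c) n) →
                members f κ fs (classes b fs) ≤ k ×
                members f κ fs (classes b fs) ≤ (b f + count f fs) ∸ q * k
    members-≤ []        = z≤n , z≤n
    members-≤ (f′ ∷ fs) with members-≤ fs | f′ Finₚ.≟ f
    ... | ≤k , ≤r | no  _    = ≤k , ≤r
    ... | ≤k , ≤r | yes refl with class b f (count f fs) ℕₚ.≟ κ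
    ...   | no ≢κ rewrite dec-false (class b f (count f fs) ℕₚ.≟ κ) ≢κ =
      ≤k , ℕₚ.≤-trans ≤r (ℕₚ.∸-monoˡ-≤ (q * k) (ℕₚ.+-monoʳ-≤ (b f) (ℕₚ.n≤1+n _)))
    ...   | yes eq rewrite dec-true (class b f (count f fs) ℕₚ.≟ κ) eq =
      ℕₚ.≤-trans (s≤s ≤r) t∸qk<k , (begin
      suc (members f κ fs (classes b fs)) ≤⟨ s≤s ≤r ⟩
      suc (t ∸ q * k)                     ≡⟨ ℕₚ.+-∸-assoc 1 qk≤t ⟨
      suc t ∸ q * k                       ≡⟨ cong (_∸ q * k) (ℕₚ.+-suc (b f) (count f fs)) ⟨
      b f + suc (count f fs) ∸ q * k      ∎)
      where
      open ℕₚ.≤-Reasoning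
      t = b f + count f fs
      q≡ : q ≡ t / k
      q≡ = trans (cong (_∸ toℕ f) (sym eq)) (ℕₚ.m+n∸n≡m (t / k) (toℕ f))
      qk≤t : q * k ≤ t
      qk≤t = subst (λ q → q * k ≤ t) (sym q≡) (m/n*n≤m t k)
      t∸qk<k : t ∸ q * k < k
      t∸qk<k = subst (_< k) (sym (trans (cong (λ q → t ∸ q * k) q≡)
        (trans (cong (_∸ t / k * k) (m≡m%n+[m/n]*n t k)) (ℕₚ.m+n∸n≡m (t % k) (t / k * k))))) (m%n<n t k)

  refine : ∀ {n} (fs : Vec (Fin c) n) → ∃ λ ℓs →
    Pointwise (λ _ ℓ → ℓ < n / k + c) fs ℓs ×
    (∀ κ → total₂ (λ _ ℓ → 1 when ℓ ℕₚ.≟ κ) fs ℓs ≤ k) ×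
    (∀ κ → ∃ λ f → Pointwise (λ f′ ℓ → ℓ ≡ κ → f′ ≡ f) fs ℓs)
  refine {n} fs = classes b fs , Pw.map (HasRank⇒< b cap n sep top) ranks , small , mono
    where
    b cap : Fin c → ℕ
    b f = below f fs
    cap f = count f fs
    sep : ∀ {f f′} → f Fin.< f′ → b f + cap f ≤ b f′
    sep {f} {f′} f<f′ = total-+-≤
      (λ x → when-disjoint 1 (x Finₚ.<? f) (x Finₚ.≟ f) (x Finₚ.<? f′)
        (λ x<f → Finₚ.<-trans x<f f<f′) (λ { refl → f<f′ }) λ { x<f refl → Finₚ.<-irrefl refl x<f }) fs
    top : ∀ f → b f + cap f ≤ n
    top f = subst (b f + cap f ≤_) (total-1 fs) (total-+-≤
      (λ x → when-disjoint 1 (x Finₚ.<? f) (x Finₚ.≟ f) (yes tt) _ _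
        λ { x<f refl → Finₚ.<-irrefl refl x<f }) fs)
    ranks = classes-HasRank b cap n sep top fs (λ _ → ℕₚ.≤-refl)
    mono : ∀ κ → ∃ λ f → Pointwise (λ f′ ℓ → ℓ ≡ κ → f′ ≡ f) fs (classes b fs)
    mono = monochromatic b cap n sep top ranks
    -- All members of class `κ` have the hue `f`, so counting only those of hue `f` loses nothing.
    small : ∀ κ → total₂ (λ _ ℓ → 1 when ℓ ℕₚ.≟ κ) fs (classes b fs) ≤ k
    small κ with mono κ
    ... | f , hs = ℕₚ.≤-trans
      (total₂-mono (Pw.map (λ {f′} {ℓ} → when-when 1 (ℓ ℕₚ.≟ κ) (f′ Finₚ.≟ f)) hs))
      (proj₁ (members-≤ b f κ fs))

-- Moves with rational data and the game

-- The site s stands for the unit interval [s/4, s/4 + 1].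
Site : Set
Site = Fin 7

-- Distance exactly 4 is included: the intervals are closed and then share an endpoint, as those at
-- `1F` and `5F` do.
Touch : Site → Site → Set
Touch s s′ = toℕ s ≤ toℕ s′ + 4 × toℕ s′ ≤ toℕ s + 4

touch? : ∀ s s′ → Dec (Touch s s′)
touch? s s′ = (toℕ s ℕₚ.≤? toℕ s′ + 4) ×-dec (toℕ s′ ℕₚ.≤? toℕ s + 4)

touch-refl : ∀ {s} → Touch s s
touch-refl {s} = ℕₚ.m≤m+n (toℕ s) 4 , ℕₚ.m≤m+n (toℕ s) 4

-- A proper 2-coloring of the touching relation on the sites in use. Being decidable, it is later
-- checked by evaluation.
Alternating : (Site → Maybe Bool) → Set
Alternating cls = ∀ s s′ → Touch s s′ → cls s ≡ cls s′ → s ≡ s′ ⊎ cls s ≡ nothing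

alternating? : ∀ cls → Dec (Alternating cls)
alternating? cls = Finₚ.all? λ s → Finₚ.all? λ s′ → touch? s s′ →-dec
  (Maybeₚ.≡-dec Boolₚ._≟_ (cls s) (cls s′) →-dec
    ((s Finₚ.≟ s′) ⊎-dec Maybeₚ.≡-dec Boolₚ._≟_ (cls s) nothing))

-- `IsColoring` gives bounds only for a supplied set `S`. At the points that are multiples of a
-- quarter, membership is decidable and `S` can be built.
select : ∀ {n} {P : Fin n → Set} → (∀ i → Dec (P i)) → ∃ λ S → ∀ i → i ∈ S ⇔ P i
select {zero}  P? = [] , λ ()
select {suc n} {P} P? with P? zero | select (P? ∘ suc)
... | yes p | S , h = inside ∷ S , λ
  { zero    → mk⇔ (λ _ → p) (λ _ → Vec.here)
  ; (suc i) → mk⇔ (Equivalence.to (h i) ∘ drop-there) (Vec.there ∘ Equivalence.from (h i)) }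
... | no ¬p | S , h = outside ∷ S , λ
  { zero    → mk⇔ (λ ()) (λ p → contradiction p ¬p)
  ; (suc i) → mk⇔ (Equivalence.to (h i) ∘ drop-there) (Vec.there ∘ Equivalence.from (h i)) }

selected : ∀ {X : Set} {n} → (X → ℕ) → Subset n → Vec X n → ℕ
selected v []            []       = 0
selected v (inside  ∷ S) (x ∷ xs) = v x + selected v S xs
selected v (outside ∷ S) (x ∷ xs) = selected v S xs

selected-1 : ∀ {X : Set} {n} S (xs : Vec X n) → selected (const 1) S xs ≡ card S
selected-1 []            []       = refl
selected-1 (inside  ∷ S) (x ∷ xs) = cong suc (selected-1 S xs)
selected-1 (outside ∷ S) (x ∷ xs) = selected-1 S xs

∈⇒≤-selected : ∀ {X : Set} {n} v {S i} (xs : Vec X n) → i ∈ S → v (lookup xs i) ≤ selected v S xs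
∈⇒≤-selected v {inside  ∷ S} (x ∷ xs) Vec.here      = ℕₚ.m≤m+n (v x) _
∈⇒≤-selected v {inside  ∷ S} (x ∷ xs) (Vec.there p) = ℕₚ.≤-trans (∈⇒≤-selected v xs p) (ℕₚ.m≤n+m _ (v x))
∈⇒≤-selected v {outside ∷ S} (x ∷ xs) (Vec.there p) = ∈⇒≤-selected v xs p

selected≤total₂ : ∀ {X Y : Set} {n} v {P : X → Y → Set} (P? : ∀ x y → Dec (P x y))
                  S (xs : Vec X n) ys → (∀ {i} → i ∈ S → P (lookup xs i) (lookup ys i)) →
                  selected v S xs ≤ total₂ (λ x y → v x when P? x y) xs ys
selected≤total₂ v P? []            []       []       h = z≤n
selected≤total₂ v P? (outside ∷ S) (x ∷ xs) (y ∷ ys) h =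
  ℕₚ.≤-trans (selected≤total₂ v P? S xs ys (h ∘ Vec.there)) (ℕₚ.m≤n+m _ (v x when P? x y))
selected≤total₂ v P? (inside  ∷ S) (x ∷ xs) (y ∷ ys) h =
  ℕₚ.+-mono-≤ (when-mono (v x) (yes (h Vec.here)) (P? x y) (λ p → p))
              (selected≤total₂ v P? S xs ys (h ∘ Vec.there))

unique-used⇒≤-#colors : ∀ {n} (cs : Vec ℕ n) {C} → Unique C → (∀ {γ} → γ L.∈ C → γ L.∈ toList cs) →
                        length C ≤ #colors cs
unique-used⇒≤-#colors cs uniq sub =
  unique-⊆⇒length-≤ _ uniq (Lₚ.∈-deduplicate⁺ ℕₚ._≟_ ∘ sub)

#colors-≤ : ∀ {n} (cs : Vec ℕ n) N → All (_< N) cs → #colors cs ≤ N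
#colors-≤ cs N all<N = subst (#colors cs ≤_) (Listₚ.length-upTo N)
  (unique-⊆⇒length-≤ (upTo N) (DecUniqueₚ.deduplicate-! ℕₚ._≟_ (toList cs))
    λ c∈ → Lₚ.∈-upTo⁺ (LAll.lookup (Allₚ.toList⁺ all<N) (Lₚ.∈-deduplicate⁻ ℕₚ._≟_ (toList cs) c∈)))

module Game (d k M : ℕ) .{{_ : NonZero M}} (lower upper : ℝ) where

  -- Weights are counted in units of `1 / M`, so that all sums can be compared in `ℕ`.
  record Move : Set where
    field
      site : Site
      wt   : Fin d → ℕ
      wt≤M : ∀ j → wt j ≤ M

  open Move public

  Played : Set
  Played = Move × ℕ

  quarters : ℕ → ℚ
  quarters n = ℤ.+ n ℚ./ 4

  quarters-mono : ∀ a b → a ≤ b → fromℚ (quarters a) ≤ᴿ fromℚ (quarters b)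
  quarters-mono a b a≤b =
    pointwise-≤ᴿ (fromℚ (quarters a)) (fromℚ (quarters b))
      λ _ → frac-mono a b 4 4 (ℕₚ.*-monoˡ-≤ 4 a≤b)

  quarters-cancel : ∀ a b → fromℚ (quarters a) ≤ᴿ fromℚ (quarters b) → a ≤ b
  quarters-cancel a b h = ℕₚ.*-cancelʳ-≤ a b 4 (frac-cancel a b 4 4 (fromℚ-cancel h))

  interval : Move → WeightedInterval d
  interval x .left         = fromℚ (quarters (toℕ (site x)))
  interval x .right        = fromℚ (quarters (toℕ (site x) + 4))
  interval x .left≤right   = quarters-mono (toℕ (site x)) (toℕ (site x) + 4) (ℕₚ.m≤m+n (toℕ (site x)) 4)
  interval x .weight j     = fromℚ (ℤ.+ wt x j ℚ./ M)
  interval x .0≤weight j   = pointwise-≤ᴿ 0ᴿ (fromℚ (ℤ.+ wt x j ℚ./ M)) λ _ → frac-mono 0 (wt x j) 1 M z≤n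
  interval x .weight≤1 j   = pointwise-≤ᴿ (fromℚ (ℤ.+ wt x j ℚ./ M)) 1ᴿ λ _ →
    frac-mono (wt x j) 1 M 1 (subst₂ _≤_ (sym (ℕₚ.*-identityʳ _)) (sym (ℕₚ.*-identityˡ M)) (wt≤M x j))

  interval-unit : ∀ x → IsUnit (interval x)
  interval-unit x =
    pointwise-≤ᴿ (len (interval x)) 1ᴿ (λ _ → ℚₚ.≤-reflexive len≡1) ,
    pointwise-≤ᴿ 1ᴿ (len (interval x)) (λ _ → ℚₚ.≤-reflexive (sym len≡1))
    where
    open ℚ-Solver
    len≡1 : quarters (toℕ (site x) + 4) ℚ.- quarters (toℕ (site x)) ≡ 1ℚ
    len≡1 = trans (cong (ℚ._- quarters (toℕ (site x))) (sym (frac-+ (toℕ (site x)) 4 4)))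
      (solve 2 (λ a b → (a :+ b) :- a := b) refl (quarters (toℕ (site x))) (quarters 4))

  intervals : ∀ {n} → Vec Played n → Vec (WeightedInterval d) n
  intervals = Vec.map (interval ∘ proj₁)

  colors : ∀ {n} → Vec Played n → Vec ℕ n
  colors = Vec.map proj₂

  ∑-weights : ∀ {n} S (H : Vec Played n) j i →
              seq (∑[ S ] (λ i → weight (lookup (intervals H) i) j)) i
              ≡ ℤ.+ selected (λ x → wt (proj₁ x) j) S H ℚ./ M
  ∑-weights []            []      j i = sym (ℚₚ.0/n≡0 M)
  ∑-weights (outside ∷ S) (x ∷ H) j i = ∑-weights S H j i
  ∑-weights (inside  ∷ S) (x ∷ H) j i =
    trans (cong ((ℤ.+ wt (proj₁ x) j ℚ./ M) ℚ.+_) (∑-weights S H j i)) (frac-+ (wt (proj₁ x) j) _ M)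

  ∑≤1⇒selected≤M : ∀ {n} S (H : Vec Played n) j →
                   ∑[ S ] (λ i → weight (lookup (intervals H) i) j) ≤ᴿ 1ᴿ →
                   selected (λ x → wt (proj₁ x) j) S H ≤ M
  ∑≤1⇒selected≤M S H j h = subst₂ _≤_ (ℕₚ.*-identityʳ T) (ℕₚ.*-identityˡ M)
    (frac-cancel T 1 M 1 (fromℚ-cancel {ℤ.+ T ℚ./ M} {1ℚ} λ ε 0<ε → let N , le = h ε 0<ε in
      N , λ i N≤i → subst (ℚ._≤ 1ℚ ℚ.+ ε) (∑-weights S H j i) (le i N≤i)))
    where T = selected (λ x → wt (proj₁ x) j) S H

  selected≤M⇒∑≤1 : ∀ {n} S (H : Vec Played n) j →
                   selected (λ x → wt (proj₁ x) j) S H ≤ M →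
                   ∑[ S ] (λ i → weight (lookup (intervals H) i) j) ≤ᴿ 1ᴿ
  selected≤M⇒∑≤1 S H j T≤M = pointwise-≤ᴿ (∑[ S ] (λ i → weight (lookup (intervals H) i) j)) 1ᴿ λ i →
    subst (ℚ._≤ 1ℚ) (sym (∑-weights S H j i))
      (frac-mono T 1 M 1 (subst₂ _≤_ (sym (ℕₚ.*-identityʳ T)) (sym (ℕₚ.*-identityˡ M)) T≤M))
    where T = selected (λ x → wt (proj₁ x) j) S H

  -- This consequence of a valid coloring concerns only pairs that include the new interval. It is
  -- decidable, so that a strategy can branch on it.
  Compatible : ∀ {n} → Move → ℕ → Vec Played n → Set
  Compatible x γ = All λ y → proj₂ y ≡ γ → Touch (site x) (site (proj₁ y)) →
                             ∀ j → wt x j + wt (proj₁ y) j ≤ M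

  compatible? : ∀ {n} x γ (H : Vec Played n) → Dec (Compatible x γ H)
  compatible? x γ = All.all? λ y →
    (proj₂ y ℕₚ.≟ γ) →-dec (touch? (site x) (site (proj₁ y)) →-dec
      Finₚ.all? λ j → wt x j + wt (proj₁ y) j ℕₚ.≤? M)

  contains? : ∀ x n → Dec (interval x contains fromℚ (quarters n))
  contains? x n =
    map′ (quarters-mono l n) (quarters-cancel l n) (l ℕₚ.≤? n) ×-dec
    map′ (quarters-mono n (l + 4)) (quarters-cancel n (l + 4)) (n ℕₚ.≤? l + 4)
    where l = toℕ (site x)

  contains-intro : ∀ x n → toℕ (site x) ≤ n → n ≤ toℕ (site x) + 4 →
                   interval x contains fromℚ (quarters n)
  contains-intro x n l≤n n≤r = quarters-mono (toℕ (site x)) n l≤n , quarters-mono n (toℕ (site x) + 4) n≤r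

  -- The larger of the two left endpoints lies in both intervals, so both weights enter the sum of
  -- color `γ` at that point.
  coloring⇒compatible : ∀ {n} x γ (H : Vec Played n) →
    IsColoring k (interval x ∷ intervals H) (γ ∷ colors H) → Compatible x γ H
  coloring⇒compatible {n} x γ H col = Allₚ.lookup⁻ λ i → fits i
    where
    H′ = (x , γ) ∷ H
    fits : ∀ i → proj₂ (lookup H i) ≡ γ → Touch (site x) (site (proj₁ (lookup H i))) →
           ∀ j → wt x j + wt (proj₁ (lookup H i)) j ≤ M
    fits i γ≡ (x≤y , y≤x) j = bound (select here?)
      where
      y = proj₁ (lookup H i)
      p = toℕ (site x) ⊔ toℕ (site y)
      Here : Fin (suc n) → Set
      Here i = lookup (intervals H′) i contains fromℚ (quarters p) × lookup (colors H′) i ≡ γ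
      here? : ∀ i → Dec (Here i)
      here? i =
        subst (λ I → Dec (I contains fromℚ (quarters p))) (sym (Vecₚ.lookup-map i (interval ∘ proj₁) H′))
          (contains? (proj₁ (lookup H′ i)) p)
        ×-dec lookup (colors H′) i ℕₚ.≟ γ
      x-here : Here zero
      x-here = contains-intro x p (ℕₚ.m≤m⊔n (toℕ (site x)) (toℕ (site y))) (ℕₚ.⊔-lub (ℕₚ.m≤m+n _ 4) y≤x) , refl
      y-here : Here (suc i)
      y-here = subst (λ I → I contains fromℚ (quarters p)) (sym (Vecₚ.lookup-map i (interval ∘ proj₁) H))
                 (contains-intro y p (ℕₚ.m≤n⊔m (toℕ (site x)) (toℕ (site y))) (ℕₚ.⊔-lub x≤y (ℕₚ.m≤m+n _ 4)))
             , trans (Vecₚ.lookup-map i proj₂ H) γ≡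
      from-members : ∀ S → (∀ i → i ∈ S ⇔ Here i) → zero ∈ S → suc i ∈ S → wt x j + wt y j ≤ M
      from-members S hS Vec.here (Vec.there y∈S) = ℕₚ.≤-trans
        (ℕₚ.+-monoʳ-≤ (wt x j) (∈⇒≤-selected (λ x → wt (proj₁ x) j) H y∈S))
        (∑≤1⇒selected≤M S H′ j (proj₂ (col γ (fromℚ (quarters p)) S hS) j))
      bound : ∃ (λ S → ∀ i → i ∈ S ⇔ Here i) → wt x j + wt y j ≤ M
      bound (S , hS) = from-members S hS (Equivalence.from (hS zero) x-here) (Equivalence.from (hS (suc i)) y-here)

  At : Site → ℕ → Played → ℕ → Set
  At s κ x ℓ = site (proj₁ x) ≡ s × ℓ ≡ κ

  at? : ∀ s κ x ℓ → Dec (At s κ x ℓ)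
  at? s κ x ℓ = (site (proj₁ x) Finₚ.≟ s) ×-dec (ℓ ℕₚ.≟ κ)

  tally : ∀ {n} → (Move → ℕ) → Site → ℕ → Vec Played n → Vec ℕ n → ℕ
  tally v s κ = total₂ λ x ℓ → v (proj₁ x) when at? s κ x ℓ

  -- The labels are an off-line coloring built along with the game. They are constrained within each
  -- site only; `recolor` reconciles the sites at the end.
  Valid : ∀ {n} → Vec Played n → Vec ℕ n → Set
  Valid H ℓs = ∀ s κ → tally (const 1) s κ H ℓs ≤ k × (∀ j → tally (λ x → wt x j) s κ H ℓs ≤ M)

  recolor : ∀ {n} → (Site → ℕ → ℕ) → Vec Played n → Vec ℕ n → Vec ℕ n
  recolor f = Vec.zipWith λ x ℓ → f (site (proj₁ x)) ℓ

  -- Intervals through a common point touch pairwise. If their new colors agree as well, the last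
  -- hypothesis puts them into one label class at one site, where `Valid` applies.
  valid⇒coloring : ∀ {n} (f : Site → ℕ → ℕ) (H : Vec Played n) ℓs → Valid H ℓs →
    (∀ i i′ → let s = site (proj₁ (lookup H i)) ; s′ = site (proj₁ (lookup H i′)) in
              Touch s s′ → f s (lookup ℓs i) ≡ f s′ (lookup ℓs i′) →
              s ≡ s′ × lookup ℓs i ≡ lookup ℓs i′) →
    IsColoring k (intervals H) (recolor f H ℓs)
  valid⇒coloring f H ℓs valid inj γ p S hS = bounds (nonempty? S)
    where
    within : ∀ s κ → (∀ {i} → i ∈ S → At s κ (lookup H i) (lookup ℓs i)) →
             card S ≤ k × (∀ j → ∑[ S ] (λ i → weight (lookup (intervals H) i) j) ≤ᴿ 1ᴿ)
    within s κ h =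
      subst (_≤ k) (selected-1 S H)
        (ℕₚ.≤-trans (selected≤total₂ (const 1) (at? s κ) S H ℓs h) (proj₁ (valid s κ))) ,
      λ j → selected≤M⇒∑≤1 S H j
        (ℕₚ.≤-trans (selected≤total₂ (λ x → wt (proj₁ x) j) (at? s κ) S H ℓs h) (proj₂ (valid s κ) j))
    meet : ∀ i i′ → lookup (intervals H) i contains p → lookup (intervals H) i′ contains p →
           toℕ (site (proj₁ (lookup H i))) ≤ toℕ (site (proj₁ (lookup H i′))) + 4
    meet i i′ i∋p i′∋p
      rewrite Vecₚ.lookup-map i (interval ∘ proj₁) H | Vecₚ.lookup-map i′ (interval ∘ proj₁) H =
      quarters-cancel _ _ (≤ᴿ-trans
        (left (interval (proj₁ (lookup H i)))) p (right (interval (proj₁ (lookup H i′))))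
        (proj₁ i∋p) (proj₂ i′∋p))
    bounds : Dec (Nonempty S) → card S ≤ k × (∀ j → ∑[ S ] (λ i → weight (lookup (intervals H) i) j) ≤ᴿ 1ᴿ)
    bounds (yes (i₀ , i₀∈S)) = within (site (proj₁ (lookup H i₀))) (lookup ℓs i₀) λ {i} i∈S →
      let i∋p , i≡γ = Equivalence.to (hS i) i∈S
          i₀∋p , i₀≡γ = Equivalence.to (hS i₀) i₀∈S
      in inj i i₀ (meet i i₀ i∋p i₀∋p , meet i₀ i i₀∋p i∋p)
           (trans (sym (Vecₚ.lookup-zipWith _ i H ℓs))
             (trans (trans i≡γ (sym i₀≡γ)) (Vecₚ.lookup-zipWith _ i₀ H ℓs)))
    bounds (no ¬ne) = within zero 0 λ i∈S → contradiction (_ , i∈S) ¬ne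

  Goal : ∀ {n} → Vec (WeightedInterval d) n → Vec ℕ n → Set
  Goal Is cs = lower ≤ᴿ fromℕ (#colors cs) × Colorable k upper Is

  Winnable : ∀ {n} → Vec Played n → Set
  Winnable H = Σ (Strategy d) (Ensures k Goal (intervals H) (colors H))

  present-move : ∀ {n} {H : Vec Played n} x → (∀ γ → Compatible x γ H → Winnable ((x , γ) ∷ H)) → Winnable H
  present-move {H = H} x win = present (interval x) (interval-unit x) next , ensures
    where
    reply : ∀ γ → Dec (Compatible x γ H) → Strategy d
    reply γ (yes c) = proj₁ (win γ c)
    -- No valid coloring leads here, so the strategy may do anything.
    reply γ (no _)  = stop
    next : ℕ → Strategy d
    next γ = reply γ (compatible? x γ H)
    ensures : ∀ γ → IsColoring k (interval x ∷ intervals H) (γ ∷ colors H) →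
              Ensures k Goal (interval x ∷ intervals H) (γ ∷ colors H) (next γ)
    ensures γ col with compatible? x γ H
    ... | yes c = proj₂ (win γ c)
    ... | no ¬c = contradiction (coloring⇒compatible x γ H col) ¬c

-- The game within one group of intervals

module Groups (d k G c′ h : ℕ) .{{_ : NonZero d}} .{{_ : NonZero k}} (lower upper : ℝ)
              (c′≤h+h : c′ ≤ h + h) (d<2^c′ : d < 2 ^ c′) where

  M : ℕ
  M = suc d ^ G

  instance
    M≢0 : NonZero M
    M≢0 = ℕₚ.m^n≢0 (suc d) G

  open Refinement {c′} k
  open Game d k M lower upper

  Q : ℕ
  Q = d / k + c

  Used : ∀ {n} → Vec Played n → Site → ℕ → Set
  Used H s γ = Any (λ x → site (proj₁ x) ≡ s × proj₂ x ≡ γ) H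

  -- Such an interval shares no color with a touching interval whose weights are all at least `η`.
  Heavy : ℕ → Played → Set
  Heavy η x = ∃ λ j → M < wt (proj₁ x) j + η

  record Entry : Set where
    field
      allowed : Subset c
      hue     : Fin c
      color   : ℕ

  open Entry

  -- The newest entry stands first, so indices count from the end of the vector and stay fixed as
  -- the group grows.
  entryAt : ∀ {t} → Vec Entry t → ℕ → Maybe Entry
  entryAt []               i = nothing
  entryAt (_∷_ {t} e es) i = if does (i ℕₚ.≟ t) then just e else entryAt es i

  entryAt-≡ : ∀ {t} e (es : Vec Entry t) {i} → i ≡ t → entryAt (e ∷ es) i ≡ just e
  entryAt-≡ {t} e es {i} i≡t rewrite dec-true (i ℕₚ.≟ t) i≡t = refl

  entryAt-≢ : ∀ {t} e (es : Vec Entry t) {i} → i ≢ t → entryAt (e ∷ es) i ≡ entryAt es i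
  entryAt-≢ {t} e es {i} i≢t rewrite dec-false (i ℕₚ.≟ t) i≢t = refl

  entryAt-≥ : ∀ {t} (es : Vec Entry t) {i} → t ≤ i → entryAt es i ≡ nothing
  entryAt-≥ []       t≤i = refl
  entryAt-≥ (e ∷ es) t<i = trans (entryAt-≢ e es (ℕₚ.>⇒≢ t<i)) (entryAt-≥ es (ℕₚ.<⇒≤ t<i))

  bin : ∀ {t} → Vec Entry t → ℕ → Subset c
  bin []       γ = ⊥
  bin (e ∷ es) γ = if does (color e ℕₚ.≟ γ) then ⁅ hue e ⁆ ∪ bin es γ else bin es γ

  bin-≡ : ∀ {t} e (es : Vec Entry t) {γ} → color e ≡ γ → bin (e ∷ es) γ ≡ ⁅ hue e ⁆ ∪ bin es γ
  bin-≡ e es {γ} eq rewrite dec-true (color e ℕₚ.≟ γ) eq = refl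

  bin-≢ : ∀ {t} e (es : Vec Entry t) {γ} → color e ≢ γ → bin (e ∷ es) γ ≡ bin es γ
  bin-≢ e es {γ} neq rewrite dec-false (color e ℕₚ.≟ γ) neq = refl

  Legal : ∀ {t} → Vec Entry t → Set
  Legal []       = ⊤
  Legal (e ∷ es) = Legal es × card (allowed e) ≤ h × hue e ∈ allowed e ×
                   bin es (color e) ⊆ allowed e × hue e ∉ bin es (color e)

  palette : ∀ {t} → Vec Entry t → List ℕ
  palette es = toList (Vec.map color es)

  -- By `Legal`, when an entry is added, the new bin of its color lies in its allowed set.
  card-bin≤h : ∀ {t} (es : Vec Entry t) → Legal es → ∀ γ → card (bin es γ) ≤ h
  card-bin≤h []       _                            γ = subst (_≤ h) (sym (∣⊥∣≡0 c)) z≤n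
  card-bin≤h (e ∷ es) (legal , A≤h , f∈A , ⊆A , _) γ with color e ℕₚ.≟ γ
  ... | no neq   = subst (λ S → card S ≤ h) (sym (bin-≢ e es neq)) (card-bin≤h es legal γ)
  ... | yes refl = subst (λ S → card S ≤ h) (sym (bin-≡ e es refl)) (ℕₚ.≤-trans (p⊆q⇒∣p∣≤∣q∣ sub) A≤h)
    where
    sub : ⁅ hue e ⁆ ∪ bin es (color e) ⊆ allowed e
    sub x∈ = [ (λ x∈f → subst (_∈ allowed e) (sym (x∈⁅y⁆⇒x≡y (hue e) x∈f)) f∈A) , ⊆A ]′
               (x∈p∪q⁻ ⁅ hue e ⁆ _ x∈)

  -- Each entry brings a hue that is new to the bin of its color.
  occurrences≤card-bin : ∀ {t} (es : Vec Entry t) → Legal es → ∀ γ →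
                         occurrences γ (palette es) ≤ card (bin es γ)
  occurrences≤card-bin []       _                      γ = z≤n
  occurrences≤card-bin (e ∷ es) (legal , _ , _ , _ , f∉) γ with color e ℕₚ.≟ γ
  ... | no neq   = subst₂ (λ xs S → length xs ≤ card S)
    (sym (Listₚ.filter-reject (ℕₚ._≟ γ) neq)) (sym (bin-≢ e es neq)) (occurrences≤card-bin es legal γ)
  ... | yes refl = subst₂ (λ xs S → length xs ≤ card S)
    (sym (Listₚ.filter-accept (ℕₚ._≟ γ) {xs = palette es} refl)) (sym (bin-≡ e es refl))
    (ℕₚ.≤-<-trans (occurrences≤card-bin es legal γ)
      (p⊂q⇒∣p∣<∣q∣ (q⊆p∪q ⁅ hue e ⁆ _ , hue e , x∈p∪q⁺ (inj₁ (x∈⁅x⁆ (hue e))) , f∉)))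

  bin-unused : ∀ {t} (es : Vec Entry t) γ → γ L.∈ palette es ⊎ bin es γ ≡ ⊥
  bin-unused []       γ = inj₂ refl
  bin-unused (e ∷ es) γ with color e ℕₚ.≟ γ
  ... | yes refl = inj₁ (here refl)
  ... | no neq with bin-unused es γ
  ...   | inj₁ γ∈ = inj₁ (there γ∈)
  ...   | inj₂ eq = inj₂ (trans (bin-≢ e es neq) eq)

  fresh-allowed : ∀ {t} (es : Vec Entry t) → t < d → ∃ λ A → card A ≤ h × (∀ γ → bin es γ ≢ A)
  fresh-allowed {t} es t<d =
    let A , A≤h , A∉ = fresh-small-subset c′ h bins c′≤h+h (ℕₚ.≤-<-trans bins≤d d<2^c′) in
    A , A≤h , λ γ eq → A∉ (subst (L._∈ bins) eq (bin∈bins γ))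
    where
    bins = ⊥ ∷ List.map (bin es) (palette es)
    bins≤d : length bins ≤ d
    bins≤d = subst (_≤ d) (cong suc (sym (trans (Listₚ.length-map (bin es) (palette es))
      (Vecₚ.length-toList (Vec.map color es))))) t<d
    bin∈bins : ∀ γ → bin es γ L.∈ bins
    bin∈bins γ with bin-unused es γ
    ... | inj₁ γ∈ = there (Lₚ.∈-map⁺ (bin es) γ∈)
    ... | inj₂ eq = here eq

  fresh-hue : ∀ {S A : Subset c} → S ⊆ A → S ≢ A → ∃ λ f → f ∈ A × f ∉ S
  fresh-hue {S} {A} S⊆A S≢A with Finₚ.any? (λ f → (f ∈? A) ×-dec ¬? (f ∈? S))
  ... | yes p = p
  ... | no ¬p = contradiction (⊆-antisym S⊆A A⊆S) S≢A
    where
    A⊆S : A ⊆ S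
    A⊆S {f} f∈A with f ∈? S
    ... | yes f∈S = f∈S
    ... | no  f∉S = contradiction (f , f∈A , f∉S) ¬p

  -- The t-th interval of a group is the only one with a large weight in coordinate
  -- t. A later interval has weight ζ there if it must not share a color with the
  -- t-th one, and otherwise weight η, of which d fit beside the large weight. The
  -- next group has ζ for its η and so conflicts with all of this one.

  module Group (s : Site) (g : ℕ) (g+2≤G : 2 + g ≤ G) where

    η ζ own : ℕ
    η   = suc d ^ g
    ζ   = suc d ^ suc g
    -- `d` weights `η` fill the remaining room exactly, whereas `ζ = η + d * η` exceeds it by `η`.
    own = M ∸ d * η

    dζ≤M : d * ζ ≤ M
    dζ≤M = ℕₚ.≤-trans (ℕₚ.*-monoˡ-≤ ζ (ℕₚ.n≤1+n d)) (ℕₚ.^-monoʳ-≤ (suc d) g+2≤G)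

    ζ≤M : ζ ≤ M
    ζ≤M = ℕₚ.≤-trans (ℕₚ.m≤m*n ζ d) (subst (_≤ M) (ℕₚ.*-comm d ζ) dζ≤M)

    η≤ζ : η ≤ ζ
    η≤ζ = ℕₚ.m≤m+n η (d * η)

    1≤η : 1 ≤ η
    1≤η = ℕₚ.m^n>0 (suc d) g

    dη≤M : d * η ≤ M
    dη≤M = ℕₚ.≤-trans (ℕₚ.m≤n+m (d * η) η) ζ≤M

    own+dη≡M : own + d * η ≡ M
    own+dη≡M = ℕₚ.m∸n+n≡m dη≤M

    own+ζ≡M+η : own + ζ ≡ M + η
    own+ζ≡M+η = trans (cong (own +_) (ℕₚ.+-comm η (d * η)))
      (trans (sym (ℕₚ.+-assoc own (d * η) η)) (cong (_+ η) own+dη≡M))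

    M<own+ζ : M < own + ζ
    M<own+ζ = subst (M <_) (sym own+ζ≡M+η) (ℕₚ.m<m+n M 1≤η)

    η≤own : η ≤ own
    η≤own = ℕₚ.+-cancelʳ-≤ (d * η) η own (subst (η + d * η ≤_) (sym own+dη≡M) ζ≤M)

    small : Maybe Entry → Subset c → ℕ
    -- This is the case of a coordinate that belongs to an interval still to come.
    small nothing  A = η
    small (just e) A = if does (hue e ∈? A) then η else ζ

    η≤small : ∀ e A → η ≤ small e A
    η≤small nothing  A = ℕₚ.≤-refl
    η≤small (just e) A with hue e ∈? A
    ... | yes _ = ℕₚ.≤-refl
    ... | no  _ = η≤ζ

    small≤ζ : ∀ e A → small e A ≤ ζ
    small≤ζ nothing  A = η≤ζ
    small≤ζ (just e) A with hue e ∈? A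
    ... | yes _ = η≤ζ
    ... | no  _ = ℕₚ.≤-refl

    weightAt : ∀ {t} → Vec Entry t → Subset c → ℕ → ℕ
    weightAt {t} es A i = if does (i ℕₚ.≟ t) then own else small (entryAt es i) A

    weightAt-≡ : ∀ {t} (es : Vec Entry t) A {i} → i ≡ t → weightAt es A i ≡ own
    weightAt-≡ {t} es A {i} i≡t rewrite dec-true (i ℕₚ.≟ t) i≡t = refl

    weightAt-≢ : ∀ {t} (es : Vec Entry t) A {i} → i ≢ t → weightAt es A i ≡ small (entryAt es i) A
    weightAt-≢ {t} es A {i} i≢t rewrite dec-false (i ℕₚ.≟ t) i≢t = refl

    weightAt≤M : ∀ {t} (es : Vec Entry t) A i → weightAt es A i ≤ M
    weightAt≤M {t} es A i with i ℕₚ.≟ t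
    ... | yes i≡t = subst (_≤ M) (sym (weightAt-≡ es A i≡t)) (ℕₚ.m∸n≤m M (d * η))
    ... | no  i≢t = subst (_≤ M) (sym (weightAt-≢ es A i≢t)) (ℕₚ.≤-trans (small≤ζ (entryAt es i) A) ζ≤M)

    η≤weightAt : ∀ {t} (es : Vec Entry t) A i → η ≤ weightAt es A i
    η≤weightAt {t} es A i with i ℕₚ.≟ t
    ... | yes i≡t = subst (η ≤_) (sym (weightAt-≡ es A i≡t)) η≤own
    ... | no  i≢t = subst (η ≤_) (sym (weightAt-≢ es A i≢t)) (η≤small (entryAt es i) A)

    move : ∀ {t} → Vec Entry t → Subset c → Move
    move es A .site   = s
    move es A .wt j   = weightAt es A (toℕ j)
    move es A .wt≤M j = weightAt≤M es A (toℕ j)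

    moves : ∀ {t} → Vec Entry t → Vec Played t
    moves []       = []
    moves (e ∷ es) = (move es (allowed e) , color e) ∷ moves es

    hueLoad : ∀ {t} → Fin c → ℕ → Vec Entry t → ℕ
    hueLoad f i []       = 0
    hueLoad f i (e ∷ es) = (weightAt es (allowed e) i when hue e Finₚ.≟ f) + hueLoad f i es

    LoadBound : Fin c → ℕ → Maybe Entry → ℕ → Set
    LoadBound f t nothing  n = n ≤ t * η
    LoadBound f t (just e) n = (hue e ≡ f → n ≤ own + t * η) × (hue e ≢ f → n ≤ t * ζ)

    -- In the coordinate of an interval of hue `f`, a later interval of hue `f` has `f` in its
    -- allowed set and hence weight `η`. Intervals before the owner of a coordinate also have `η`
    -- there. In a coordinate owned by another hue, no interval of hue `f` has more than `ζ`.
    hueLoad-bound : ∀ {t} (es : Vec Entry t) → Legal es → ∀ f i →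
                    LoadBound f t (entryAt es i) (hueLoad f i es)
    hueLoad-bound []                 _     f i = z≤n
    hueLoad-bound {suc t} (e ∷ es) legal f i with i ℕₚ.≟ t
    ... | yes refl
      rewrite entryAt-≡ e es {i} refl | weightAt-≡ es (allowed e) {i} refl = same , different
      where
      rest : hueLoad f t es ≤ t * η
      rest = subst (λ m → LoadBound f t m (hueLoad f t es)) (entryAt-≥ es ℕₚ.≤-refl)
                   (hueLoad-bound es (proj₁ legal) f t)
      same : hue e ≡ f → (own when hue e Finₚ.≟ f) + hueLoad f t es ≤ own + suc t * η
      same _ = ℕₚ.+-mono-≤ (when-≤ own (hue e Finₚ.≟ f)) (ℕₚ.≤-trans rest (ℕₚ.m≤n+m (t * η) η))
      different : hue e ≢ f → (own when hue e Finₚ.≟ f) + hueLoad f t es ≤ suc t * ζ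
      different neq rewrite dec-false (hue e Finₚ.≟ f) neq =
        ℕₚ.≤-trans rest (ℕₚ.≤-trans (ℕₚ.*-monoʳ-≤ t η≤ζ) (ℕₚ.m≤n+m (t * ζ) ζ))
    ... | no i≢t
      rewrite entryAt-≢ e es i≢t | weightAt-≢ es (allowed e) i≢t =
        step (entryAt es i) (hueLoad-bound es (proj₁ legal) f i)
      where
      w : Maybe Entry → ℕ
      w m = small m (allowed e) when hue e Finₚ.≟ f
      step : ∀ m → LoadBound f t m (hueLoad f i es) → LoadBound f (suc t) m (w m + hueLoad f i es)
      step nothing   ih = ℕₚ.+-mono-≤ (when-≤ η (hue e Finₚ.≟ f)) ih
      step (just e′) (ih , ih′) = same , different
        where
        different : hue e′ ≢ f → w (just e′) + hueLoad f i es ≤ suc t * ζ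
        different neq = ℕₚ.+-mono-≤
          (ℕₚ.≤-trans (when-≤ _ (hue e Finₚ.≟ f)) (small≤ζ (just e′) (allowed e))) (ih′ neq)
        w≤η : hue e′ ≡ f → w (just e′) ≤ η
        w≤η refl with hue e Finₚ.≟ hue e′
        ... | no _ = z≤n
        ... | yes eq
          rewrite dec-true (hue e′ ∈? allowed e) (subst (_∈ allowed e) eq (proj₁ (proj₂ (proj₂ legal))))
          = ℕₚ.≤-refl
        same : hue e′ ≡ f → w (just e′) + hueLoad f i es ≤ own + suc t * η
        same eq = begin
          w (just e′) + hueLoad f i es ≤⟨ ℕₚ.+-mono-≤ (w≤η eq) (ih eq) ⟩
          η + (own + t * η)            ≡⟨ x∙yz≈y∙xz η own (t * η) ⟩
          own + (η + t * η)            ∎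
          where
          open ℕₚ.≤-Reasoning
          open import Algebra.Properties.CommutativeSemigroup ℕₚ.+-commutativeSemigroup using (x∙yz≈y∙xz)

    -- For a complete group each bound is at most `M`, so a hue class respects the weight limit of a
    -- single color.
    hueLoad≤M : ∀ (es : Vec Entry d) → Legal es → ∀ f i → hueLoad f i es ≤ M
    hueLoad≤M es legal f i = conclude (entryAt es i) (hueLoad-bound es legal f i)
      where
      conclude : ∀ m → LoadBound f d m (hueLoad f i es) → hueLoad f i es ≤ M
      conclude nothing  b       = ℕₚ.≤-trans b dη≤M
      conclude (just e) (b , b′) with hue e Finₚ.≟ f
      ... | yes eq = subst (hueLoad f i es ≤_) own+dη≡M (b eq)
      ... | no neq = ℕₚ.≤-trans (b′ neq) dζ≤M

    -- A hue of bin `γ` is traced back to an interval of color `γ` and to the coordinate `j` in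
    -- which it has its large weight; `P` carries along what is known of all moves.
    Member : ∀ {t} → (Played → Set) → Vec Entry t → ℕ → Fin c → Set
    Member {t} P es γ f = ∃ λ (j : Fin d) → ∃ λ e → ∃ λ x →
      toℕ j < t × entryAt es (toℕ j) ≡ just e × hue e ≡ f × P (x , γ) × site x ≡ s × wt x j ≡ own

    member-∷ : ∀ {t} (P : Played → Set) e (es : Vec Entry t) {γ f} →
               Member P es γ f → Member P (e ∷ es) γ f
    member-∷ P e es (j , e′ , x , j<t , at , rest) =
      j , e′ , x , ℕₚ.m≤n⇒m≤1+n j<t , trans (entryAt-≢ e es (ℕₚ.<⇒≢ j<t)) at , rest

    bin-member : ∀ {t} {P : Played → Set} (es : Vec Entry t) → t ≤ d → All P (moves es) →
                 ∀ {γ f} → f ∈ bin es γ → Member P es γ f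
    bin-member []       t≤d []       f∈ = contradiction f∈ ∉⊥
    bin-member {suc t} {P} (e ∷ es) t<d (p ∷ ps) {γ} {f} f∈ with color e ℕₚ.≟ γ
    ... | no neq = member-∷ P e es (bin-member {P = P} es (ℕₚ.<⇒≤ t<d) ps (subst (f ∈_) (bin-≢ e es neq) f∈))
    ... | yes refl with x∈p∪q⁻ ⁅ hue e ⁆ _ (subst (f ∈_) (bin-≡ e es refl) f∈)
    ...   | inj₂ f∈bin = member-∷ P e es (bin-member {P = P} es (ℕₚ.<⇒≤ t<d) ps f∈bin)
    ...   | inj₁ f∈⁅⁆ =
      fromℕ< t<d , e , move es (allowed e) , subst (_< suc t) (sym j≡t) (ℕₚ.n<1+n t) ,
      entryAt-≡ e es j≡t , sym (x∈⁅y⁆⇒x≡y (hue e) f∈⁅⁆) , p , refl , weightAt-≡ es (allowed e) j≡t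
      where
      j≡t : toℕ (fromℕ< t<d) ≡ t
      j≡t = Finₚ.toℕ-fromℕ< t<d

    Avoids : ∀ {n} → Vec Played n → ℕ → Set
    Avoids H γ = ∀ {s′} → Touch s s′ → ¬ Used H s′ γ

    -- A hue of the bin outside `A` would come from an interval with weight `own` in a coordinate
    -- where the new one has `ζ`.
    compatible⇒bin⊆ : ∀ {t} (es : Vec Entry t) A γ → t < d →
                      Compatible (move es A) γ (moves es) → bin es γ ⊆ A
    compatible⇒bin⊆ es A γ t<d comp {f} f∈ with bin-member es (ℕₚ.<⇒≤ t<d) comp f∈
    ... | j , e , x , j<t , at , refl , p , refl , wt≡ with hue e ∈? A
    ...   | yes f∈A = f∈A
    ...   | no  f∉A = contradiction (p refl (ℕₚ.m≤m+n _ 4 , ℕₚ.m≤m+n _ 4) j)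
      (ℕₚ.<⇒≱ (subst (M <_) (trans (ℕₚ.+-comm own ζ) (sym (cong₂ _+_ wt-new wt≡))) M<own+ζ))
      where
      wt-new : weightAt es A (toℕ j) ≡ ζ
      wt-new rewrite weightAt-≢ es A (ℕₚ.<⇒≢ j<t) | at | dec-false (hue e ∈? A) f∉A = refl

    -- All weights of the group, including `own`, are at least `η`, and the history is heavy for
    -- `η`.
    compatible⇒avoids : ∀ {t n} (es : Vec Entry t) A γ {H : Vec Played n} → All (Heavy η) H →
                        Compatible (move es A) γ H → Avoids H γ
    compatible⇒avoids es A γ (_ ∷ heavy) (_ ∷ comp) touch (there used) =
      compatible⇒avoids es A γ heavy comp touch used
    compatible⇒avoids es A γ ((j , M<) ∷ _) (p ∷ _) touch (here (refl , refl)) =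
      contradiction (p refl touch j) (ℕₚ.<⇒≱ (ℕₚ.<-≤-trans M< (ℕₚ.≤-trans
        (ℕₚ.+-monoʳ-≤ _ (η≤weightAt es A (toℕ j)))
        (ℕₚ.≤-reflexive (ℕₚ.+-comm _ (weightAt es A (toℕ j)))))))

    module _ {n} {H : Vec Played n} (heavy : All (Heavy η) H)
             (finish : (es : Vec Entry d) → Legal es → All (Avoids H ∘ color) es →
                       Winnable (moves es ++ H)) where

      -- The play after the group is the continuation `finish`, which may depend on the colors
      -- chosen by Algorithm; `r` intervals are still to come.
      play : ∀ r {t} (es : Vec Entry t) → r + t ≡ d → Legal es → All (Avoids H ∘ color) es →
             Winnable (moves es ++ H)
      play zero    es refl legal avoids = finish es legal avoids
      play (suc r) {t} es eq legal avoids =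
        let A , A≤h , bin≢A = fresh-allowed es t<d in present-move (move es A) (continue A A≤h bin≢A)
        where
        t<d : t < d
        t<d = subst (suc t ≤_) eq (s≤s (ℕₚ.m≤n+m t r))
        continue : ∀ A → card A ≤ h → (∀ γ → bin es γ ≢ A) →
                   ∀ γ → Compatible (move es A) γ (moves es ++ H) →
                   Winnable ((move es A , γ) ∷ (moves es ++ H))
        continue A A≤h bin≢A γ comp =
          let comp-es , comp-H = Allₚ.++⁻ (moves es) comp
              bin⊆A = compatible⇒bin⊆ es A γ t<d comp-es
              f , f∈A , f∉bin = fresh-hue bin⊆A (bin≢A γ)
          in play r (record { allowed = A ; hue = f ; color = γ } ∷ es)
               (trans (ℕₚ.+-suc r t) eq) (legal , A≤h , f∈A , bin⊆A , f∉bin)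
               (compatible⇒avoids es A γ heavy comp-H ∷ avoids)

    -- Each interval is heavy in its own coordinate. The `ζ` of this group is the `η` of the next
    -- one.
    moves-heavy : ∀ {t} (es : Vec Entry t) → t ≤ d → All (Heavy ζ) (moves es)
    moves-heavy []       _   = []
    moves-heavy (e ∷ es) t<d =
      (fromℕ< t<d , subst (λ w → M < w + ζ) (sym (weightAt-≡ es (allowed e) (Finₚ.toℕ-fromℕ< t<d))) M<own+ζ)
      ∷ moves-heavy es (ℕₚ.<⇒≤ t<d)

    palette-used : ∀ {t} (es : Vec Entry t) {γ} → γ L.∈ palette es → Used (moves es) s γ
    palette-used (e ∷ es) (here refl) = here (refl , refl)
    palette-used (e ∷ es) (there γ∈)  = there (palette-used es γ∈)

    palette-all : ∀ {t} {P : ℕ → Set} {es : Vec Entry t} → All (P ∘ color) es → ∀ {γ} → γ L.∈ palette es → P γ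
    palette-all (p ∷ ps) (here refl) = p
    palette-all (p ∷ ps) (there γ∈)  = palette-all ps γ∈

    hues : ∀ {t} → Vec Entry t → Vec (Fin c) t
    hues = Vec.map hue

    tally-count : ∀ {t} (es : Vec Entry t) κs b κ →
                  tally (const 1) s (b + κ) (moves es) (Vec.map (b +_) κs)
                  ≤ total₂ (λ _ ℓ → 1 when ℓ ℕₚ.≟ κ) (hues es) κs
    tally-count []       []       b κ = z≤n
    tally-count (e ∷ es) (ℓ ∷ κs) b κ = ℕₚ.+-mono-≤
      (when-mono 1 (at? s (b + κ) (move es (allowed e) , color e) (b + ℓ)) (ℓ ℕₚ.≟ κ)
        (λ at → ℕₚ.+-cancelˡ-≡ b ℓ κ (proj₂ at)))
      (tally-count es κs b κ)

    -- A class has a single hue `f`, so its load is part of the load of `f`.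
    tally-load : ∀ {t} (es : Vec Entry t) κs b κ f j →
                 Pointwise (λ f′ ℓ → ℓ ≡ κ → f′ ≡ f) (hues es) κs →
                 tally (λ x → wt x j) s (b + κ) (moves es) (Vec.map (b +_) κs) ≤ hueLoad f (toℕ j) es
    tally-load []       []       b κ f j []       = z≤n
    tally-load (e ∷ es) (ℓ ∷ κs) b κ f j (p ∷ ps) = ℕₚ.+-mono-≤
      (when-mono _ (at? s (b + κ) (move es (allowed e) , color e) (b + ℓ)) (hue e Finₚ.≟ f)
        (λ at → p (ℕₚ.+-cancelˡ-≡ b ℓ κ (proj₂ at))))
      (tally-load es κs b κ f j ps)

    tally-outside : ∀ {t} (es : Vec Entry t) κs b v s′ ℓ → ¬ (s ≡ s′ × b ≤ ℓ) →
                    tally v s′ ℓ (moves es) (Vec.map (b +_) κs) ≡ 0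
    tally-outside []       []       b v s′ ℓ out = refl
    tally-outside (e ∷ es) (κ ∷ κs) b v s′ ℓ out
      rewrite dec-false (at? s′ ℓ (move es (allowed e) , color e) (b + κ))
                (λ { (refl , refl) → out (refl , ℕₚ.m≤m+n b κ) }) =
      tally-outside es κs b v s′ ℓ out

  -- Positions between groups and their off-line labels

  record Position (size : Site → ℕ) (g : ℕ) : Set where
    field
      {rounds} : ℕ
      history  : Vec Played rounds
      labels   : Vec ℕ rounds
      -- `suc d ^ g` is the least weight in the next group.
      heavy    : All (Heavy (suc d ^ g)) history
      -- `size s` counts the groups at `s`, each with its own block of `Q` labels.
      fits     : Pointwise (λ x ℓ → ℓ < size (site (proj₁ x)) * Q) history labels
      valid    : Valid history labels

  open Position

  start : Position (const 0) 0
  start = record { history = [] ; labels = [] ; heavy = [] ; fits = [] ; valid = λ s κ → z≤n , λ j → z≤n }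

  relax : ∀ {size size′ g} → (∀ s → size s ≤ size′ s) → Position size g → Position size′ g
  relax h pos = record
    { history = history pos ; labels = labels pos ; heavy = heavy pos ; valid = valid pos
    ; fits = Pw.map (λ {x} ℓ< → ℕₚ.<-≤-trans ℓ< (ℕₚ.*-monoˡ-≤ Q (h (site (proj₁ x))))) (fits pos) }

  -- `new` lists colors forced at `s` since `pos`. They are fresh only relative to the touching
  -- sites; sites farther away may have used them.
  record Extends {size size′ g g′} (pos : Position size g) (pos′ : Position size′ g′)
                 (s : Site) (w : ℕ) : Set where
    field
      keeps      : ∀ {s′ γ} → Used (history pos) s′ γ → Used (history pos′) s′ γ
      new        : List ℕ
      new-unique : Unique new
      new-length : w ≤ length new
      new-used   : ∀ {γ} → γ L.∈ new → Used (history pos′) s γ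
      new-avoids : ∀ {γ s′} → γ L.∈ new → Touch s s′ → ¬ Used (history pos) s′ γ

  open Extends

  tally-unlabelled : ∀ {n} {size : Site → ℕ} {H : Vec Played n} {ℓs : Vec ℕ n} v s ℓ →
    Pointwise (λ x ℓ → ℓ < size (site (proj₁ x)) * Q) H ℓs → size s * Q ≤ ℓ →
    tally v s ℓ H ℓs ≡ 0
  tally-unlabelled v s ℓ fits b≤ℓ = total₂-0 (Pw.map
    (λ {x} {ℓ′} ℓ′< → cong (λ b → if b then v (proj₁ x) else 0)
      (dec-false (at? s ℓ x ℓ′) λ { (refl , refl) → ℕₚ.<⇒≱ ℓ′< b≤ℓ })) fits)

  size≤update : ∀ (size : Site → ℕ) s {f} → (∀ n → n ≤ f n) → ∀ s′ → size s′ ≤ Vector.updateAt size s f s′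
  size≤update size s n≤fn s′ with s′ Finₚ.≟ s
  ... | yes refl = subst (size s ≤_) (sym (Vectorₚ.updateAt-updates s size)) (n≤fn (size s))
  ... | no  s′≢s = ℕₚ.≤-reflexive (sym (Vectorₚ.updateAt-minimal s′ s size s′≢s))

  -- `w` stands for `⌈d / h⌉`, the number of colors forced by `d` intervals if each color occurs at
  -- most `h` times.
  module _ (w : ℕ) (w-least : ∀ n → d ≤ n * h → w ≤ n) where

    group : ∀ {size g} (pos : Position size g) s → 2 + g ≤ G →
            (∀ (pos′ : Position (Vector.updateAt size s suc) (suc g)) → Extends pos pos′ s w →
             Winnable (history pos′)) →
            Winnable (history pos)
    group {size} {g} pos s g+2≤G win = play (heavy pos) finish d [] (ℕₚ.+-identityʳ d) tt []
      where
      open Group s g g+2≤G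
      H = history pos
      finish : (es : Vec Entry d) → Legal es → All (Avoids H ∘ color) es → Winnable (moves es ++ H)
      finish es legal avoids = win pos′ ext
        where
        κs = proj₁ (refine (hues es))
        κs<Q = proj₁ (proj₂ (refine (hues es)))
        κs-count = proj₁ (proj₂ (proj₂ (refine (hues es))))
        κs-mono = proj₂ (proj₂ (proj₂ (refine (hues es))))
        -- All earlier labels at `s` are below `b`, so no label class at `s` meets two groups.
        b = size s * Q
        size′ = Vector.updateAt size s suc
        labels-fit : ∀ {t} (es : Vec Entry t) {κs : Vec ℕ t} → Pointwise (λ _ ℓ → ℓ < Q) (hues es) κs →
                     Pointwise (λ x ℓ → ℓ < size′ (site (proj₁ x)) * Q) (moves es) (Vec.map (b +_) κs)
        labels-fit []       []            = []
        labels-fit (e ∷ es) {κ ∷ _} (κ<Q ∷ κs<Q) =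
          subst (λ n → b + κ < n * Q) (sym (Vectorₚ.updateAt-updates s size))
            (subst (b + κ <_) (ℕₚ.+-comm b Q) (ℕₚ.+-monoʳ-< b κ<Q)) ∷ labels-fit es κs<Q
        module _ (v : Move → ℕ) (s′ : Site) (ℓ : ℕ) where
          tally-split : tally v s′ ℓ (moves es ++ H) (Vec.map (b +_) κs ++ labels pos)
                        ≡ tally v s′ ℓ (moves es) (Vec.map (b +_) κs) + tally v s′ ℓ H (labels pos)
          tally-split = total₂-++ _ (moves es) (Vec.map (b +_) κs)
          -- To any site and label, either the history or the new group contributes nothing.
          tally-bound : ∀ {K} → tally v s′ ℓ H (labels pos) ≤ K →
                        (∀ κ → tally v s (b + κ) (moves es) (Vec.map (b +_) κs) ≤ K) →
                        tally v s′ ℓ (moves es ++ H) (Vec.map (b +_) κs ++ labels pos) ≤ K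
          tally-bound {K} old new with (s Finₚ.≟ s′) ×-dec (b ℕₚ.≤? ℓ)
          ... | no out = subst (_≤ K)
            (sym (trans tally-split
              (cong (_+ tally v s′ ℓ H (labels pos)) (tally-outside es κs b v s′ ℓ out)))) old
          ... | yes (refl , b≤ℓ) = subst (_≤ K)
            (sym (trans tally-split (trans
              (cong (tally v s ℓ (moves es) (Vec.map (b +_) κs) +_)
                (tally-unlabelled {size = size} v s ℓ (fits pos) b≤ℓ))
              (ℕₚ.+-identityʳ _))))
            (subst (λ ℓ → tally v s ℓ (moves es) (Vec.map (b +_) κs) ≤ K) (ℕₚ.m+[n∸m]≡n b≤ℓ) (new (ℓ ∸ b)))
        pos′ : Position size′ (suc g)
        pos′ = record
          { history = moves es ++ H
          ; labels  = Vec.map (b +_) κs ++ labels pos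
          ; heavy   = Allₚ.++⁺ (moves-heavy es ℕₚ.≤-refl)
              (All.map (λ { (j , M<) → j , ℕₚ.<-≤-trans M< (ℕₚ.+-monoʳ-≤ _ η≤ζ) }) (heavy pos))
          ; fits    = Pw.++⁺ (labels-fit es κs<Q)
              (fits (relax (size≤update size s ℕₚ.n≤1+n) pos))
          ; valid   = λ s′ ℓ →
              tally-bound (const 1) s′ ℓ (proj₁ (valid pos s′ ℓ))
                (λ κ → ℕₚ.≤-trans (tally-count es κs b κ) (κs-count κ)) ,
              λ j → tally-bound (λ x → wt x j) s′ ℓ (proj₂ (valid pos s′ ℓ) j)
                (λ κ → let f , mono = κs-mono κ in
                  ℕₚ.≤-trans (tally-load es κs b κ f j mono) (hueLoad≤M es legal f (toℕ j)))
          }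
        new-colors = deduplicate ℕₚ._≟_ (palette es)
        ∈-palette : ∀ {γ} → γ L.∈ new-colors → γ L.∈ palette es
        ∈-palette = Lₚ.∈-deduplicate⁻ ℕₚ._≟_ (palette es)
        ext : Extends pos pos′ s w
        ext = record
          { keeps      = Anyₚ.++⁺ʳ (moves es)
          ; new        = new-colors
          ; new-unique = DecUniqueₚ.deduplicate-! ℕₚ._≟_ (palette es)
          ; new-length = w-least (length new-colors)
              (subst (_≤ length new-colors * h) (Vecₚ.length-toList (Vec.map color es))
              (length≤occurrences h new-colors (palette es) (Lₚ.∈-deduplicate⁺ ℕₚ._≟_)
                λ γ → ℕₚ.≤-trans (occurrences≤card-bin es legal γ) (card-bin≤h es legal γ)))
          ; new-used   = λ γ∈ → Anyₚ.++⁺ˡ (palette-used es (∈-palette γ∈))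
          ; new-avoids = λ γ∈ touch → palette-all avoids (∈-palette γ∈) touch
          }

    -- A site touches itself, so successive groups there have disjoint colors and the numbers `w`
    -- add up.
    groups : ∀ q {size g} (pos : Position size g) s → suc (q + g) ≤ G →
             (∀ (pos′ : Position (Vector.updateAt size s (q +_)) (q + g)) → Extends pos pos′ s (q * w) →
              Winnable (history pos′)) →
             Winnable (history pos)
    -- Here `relax` only exchanges size functions that are pointwise equal.
    groups zero    {size} pos s g<G win = win (relax (size≤update size s λ _ → ℕₚ.≤-refl) pos) (record
      { keeps = λ u → u ; new = [] ; new-unique = [] ; new-length = z≤n
      ; new-used = λ () ; new-avoids = λ () })
    groups (suc q) {size} pos s g<G win = groups q pos s (ℕₚ.<⇒≤ g<G) λ pos₁ ext₁ →
      group pos₁ s g<G λ pos₂ ext₂ →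
      win (relax (λ s′ → ℕₚ.≤-reflexive (Vectorₚ.updateAt-updateAt s size s′)) pos₂) (record
        { keeps      = keeps ext₂ ∘ keeps ext₁
        ; new        = new ext₂ List.++ new ext₁
        ; new-unique = Uniqueₚ.++⁺ (new-unique ext₂) (new-unique ext₁)
            λ { (γ∈₂ , γ∈₁) → new-avoids ext₂ γ∈₂ (touch-refl {s}) (new-used ext₁ γ∈₁) }
        ; new-length = subst (suc q * w ≤_) (sym (Listₚ.length-++ (new ext₂)))
            (ℕₚ.+-mono-≤ (new-length ext₂) (new-length ext₁))
        ; new-used   = λ γ∈ → [ new-used ext₂ , keeps ext₂ ∘ new-used ext₁ ]′ (Lₚ.∈-++⁻ (new ext₂) γ∈)
        ; new-avoids = λ γ∈ touch → [ (λ γ∈₂ → new-avoids ext₂ γ∈₂ touch ∘ keeps ext₁)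
                                    , (λ γ∈₁ → new-avoids ext₁ γ∈₁ touch) ]′ (Lₚ.∈-++⁻ (new ext₂) γ∈)
        })

  -- The n groups at a site get n blocks of Q colors: blocks from a on if the site
  -- has class just true, blocks below a if it has class just false. No group is
  -- played at a site of class nothing.

  Bounded : ℕ → ℕ → Maybe Bool → ℕ → Set
  Bounded a m nothing      n = n ≡ 0
  Bounded a m (just false) n = n ≤ a
  Bounded a m (just true)  n = a + n ≤ m

  base : ℕ → Maybe Bool → ℕ
  base a (just true) = a
  base a _           = 0

  block-injective : ∀ {a m} x x′ {n n′ ℓ ℓ′} → Bounded a m x n → Bounded a m x′ n′ →
                    ℓ < n * Q → ℓ′ < n′ * Q → base a x * Q + ℓ ≡ base a x′ * Q + ℓ′ →
                    x ≢ nothing × x ≡ x′ × ℓ ≡ ℓ′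
  block-injective nothing      _            refl _    ()
  block-injective (just _)     nothing      _    refl _ ()
  block-injective (just false) (just false) _    _    _ _ eq = (λ ()) , refl , eq
  block-injective {a} (just true) (just true) _  _    _ _ eq = (λ ()) , refl , ℕₚ.+-cancelˡ-≡ (a * Q) _ _ eq
  block-injective {a} (just false) (just true) n≤a _  ℓ< _ refl =
    contradiction (ℕₚ.<-≤-trans ℓ< (ℕₚ.*-monoˡ-≤ Q n≤a)) (ℕₚ.≤⇒≯ (ℕₚ.m≤m+n (a * Q) _))
  block-injective {a} (just true) (just false) _ n≤a  _ ℓ< refl =
    contradiction (ℕₚ.<-≤-trans ℓ< (ℕₚ.*-monoˡ-≤ Q n≤a)) (ℕₚ.≤⇒≯ (ℕₚ.m≤m+n (a * Q) _))

  block-< : ∀ {a m} x {n ℓ} → a ≤ m → Bounded a m x n → ℓ < n * Q → base a x * Q + ℓ < m * Q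
  block-< nothing      a≤m refl ()
  block-< (just false) a≤m n≤a ℓ< = ℕₚ.<-≤-trans ℓ< (ℕₚ.*-monoˡ-≤ Q (ℕₚ.≤-trans n≤a a≤m))
  block-< {a} {m} (just true) {n} a≤m a+n≤m ℓ< = ℕₚ.<-≤-trans (ℕₚ.+-monoʳ-< (a * Q) ℓ<)
    (subst (_≤ m * Q) (ℕₚ.*-distribʳ-+ Q a n) (ℕₚ.*-monoˡ-≤ Q a+n≤m))

  used⇒∈ : ∀ {n} {H : Vec Played n} {s γ} → Used H s γ → γ L.∈ toList (colors H)
  used⇒∈ (here (_ , refl)) = here refl
  used⇒∈ (there used)      = there (used⇒∈ used)

  module _ (m need : ℕ)
           (lower-suffices : ∀ N → need ≤ 2 * N → lower ≤ᴿ fromℕ N)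
           (upper-suffices : ∀ N → N ≤ m * Q → fromℕ N ≤ᴿ upper) where

    -- `C` bounds the colors of Algorithm from below. Off-line, the labels at sites of class
    -- `just true` are shifted by `a` blocks; touching sites then use disjoint blocks, and `m`
    -- blocks suffice. Comparing `need` with twice the length avoids halves.
    finished : ∀ {size g} (pos : Position size g) a (cls : Site → Maybe Bool) → a ≤ m →
               Alternating cls → (∀ s → Bounded a m (cls s) (size s)) →
               ∀ C → Unique C → (∀ {γ} → γ L.∈ C → ∃ λ s → Used (history pos) s γ) →
               need ≤ 2 * length C → Winnable (history pos)
    finished {size} pos a cls a≤m alternating bounded C unique used need≤ =
      stop ,
      lower-suffices (#colors (colors H))
        (ℕₚ.≤-trans need≤ (ℕₚ.*-monoʳ-≤ 2
          (unique-used⇒≤-#colors (colors H) unique (used⇒∈ ∘ proj₂ ∘ used)))) ,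
      recolor f H (labels pos) ,
      valid⇒coloring f H (labels pos) (valid pos) injective ,
      upper-suffices _ (#colors-≤ (recolor f H (labels pos)) (m * Q) (bound (fits pos)))
      where
      H = history pos
      f : Site → ℕ → ℕ
      f s ℓ = base a (cls s) * Q + ℓ
      injective : ∀ i i′ → let s = site (proj₁ (lookup H i)) ; s′ = site (proj₁ (lookup H i′)) in
                  Touch s s′ → f s (lookup (labels pos) i) ≡ f s′ (lookup (labels pos) i′) →
                  s ≡ s′ × lookup (labels pos) i ≡ lookup (labels pos) i′
      injective i i′ touch eq
        with block-injective _ _ (bounded _) (bounded _) (Pw.lookup (fits pos) i) (Pw.lookup (fits pos) i′) eq
      ... | ≢nothing , cls≡ , ℓ≡ with alternating _ _ touch cls≡
      ...   | inj₁ s≡s′     = s≡s′ , ℓ≡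
      ...   | inj₂ ≡nothing = contradiction ≡nothing ≢nothing
      bound : ∀ {n} {H : Vec Played n} {ℓs : Vec ℕ n} →
              Pointwise (λ x ℓ → ℓ < size (site (proj₁ x)) * Q) H ℓs →
              All (_< m * Q) (recolor f H ℓs)
      bound []                    = []
      bound (_∷_ {x = x} ℓ< ℓs<) = block-< (cls (site (proj₁ x))) a≤m (bounded _) ℓ< ∷ bound ℓs<

  -- The arrangement of the groups on the line

  module _ (p q w : ℕ) (w-least : ∀ n → d ≤ n * h → w ≤ n) (p≤q : p ≤ q)
           -- The longer branch plays `q + 3 * p` groups; the last of them has index one less, and
           -- `group` asks for `2 + g ≤ G`.
           (G≡ : G ≡ suc (q + (p + (p + (p + 0)))))
           (lower-suffices : ∀ N → 3 * (p * w) + 2 * (q * w) ≤ 2 * N → lower ≤ᴿ fromℕ N)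
           (upper-suffices : ∀ N → N ≤ (p + q) * Q → fromℕ N ≤ᴿ upper) where

    private
      u = p * w
      v = q * w

      <G : ∀ {n} → n ≤ q + (p + (p + (p + 0))) → suc n ≤ G
      <G n≤ = subst (_ ≤_) (sym G≡) (s≤s n≤)

      -- In the first arrangement the outer sites 0 and 6 share the lower `p` blocks. In the second,
      -- consecutive sites of the chain 0, 1, 5, 6 alternate, with the lower `q` blocks for 0 and 5.
      cls₃ cls₄ : Site → Maybe Bool
      cls₃ = lookup (just false ∷ nothing ∷ nothing ∷ just true ∷ nothing ∷ nothing ∷ just false ∷ [])
      cls₄ = lookup (just false ∷ just true ∷ nothing ∷ nothing ∷ nothing ∷ just false ∷ just true ∷ [])

    module _ {size₁ size₂ g₁ g₂} {pos₀ : Position (const 0) 0}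
             {pos₁ : Position size₁ g₁} {pos₂ : Position size₂ g₂}
             (ext₁ : Extends pos₀ pos₁ 0F u) (ext₂ : Extends pos₁ pos₂ 6F u) where

      private
        ∈new₁? : Decidable (L._∈ new ext₁)
        ∈new₁? γ = member? ℕₚ._≟_ γ (new ext₁)

        shared unshared : List ℕ
        shared   = filter ∈new₁? (new ext₂)
        unshared = filter (¬? ∘ ∈new₁?) (new ext₂)

        ∈-shared : ∀ {γ} → γ L.∈ shared → γ L.∈ new ext₂ × γ L.∈ new ext₁
        ∈-shared = Lₚ.∈-filter⁻ ∈new₁? {xs = new ext₂}

        ∈-unshared : ∀ {γ} → γ L.∈ unshared → γ L.∈ new ext₂ × ¬ γ L.∈ new ext₁
        ∈-unshared = Lₚ.∈-filter⁻ (¬? ∘ ∈new₁?) {xs = new ext₂}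

        used-0 : ∀ {γ} → γ L.∈ new ext₁ → Used (history pos₂) 0F γ
        used-0 = keeps ext₂ ∘ new-used ext₁

      union : List ℕ
      union = new ext₁ List.++ unshared

      union-used : ∀ {γ} → γ L.∈ union → Used (history pos₂) 0F γ ⊎ Used (history pos₂) 6F γ
      union-used γ∈ with Lₚ.∈-++⁻ (new ext₁) γ∈
      ... | inj₁ γ∈₁ = inj₁ (used-0 γ∈₁)
      ... | inj₂ γ∈₂ = inj₂ (new-used ext₂ (proj₁ (∈-unshared γ∈₂)))

      union-unique : Unique union
      union-unique = Uniqueₚ.++⁺ (new-unique ext₁) (Uniqueₚ.filter⁺ _ (new-unique ext₂))
        λ { (γ∈₁ , γ∈₂) → proj₂ (∈-unshared γ∈₂) γ∈₁ }

      -- Inclusion and exclusion for the colors forced at the two outer sites, doubled for the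
      -- comparison of `union` with `3 * u`.
      4u≤ : 4 * u ≤ 2 * length union + 2 * length shared
      4u≤ = begin
        4 * u
          ≡⟨ solve 1 (λ u → con 4 :* u := con 2 :* (u :+ u)) refl u ⟩
        2 * (u + u)
          ≤⟨ ℕₚ.*-monoʳ-≤ 2 (ℕₚ.+-mono-≤ (new-length ext₁) (new-length ext₂)) ⟩
        2 * (length (new ext₁) + length (new ext₂))
          ≡⟨ cong (λ n → 2 * (length (new ext₁) + n)) (length-filter-¬ ∈new₁? (new ext₂)) ⟨
        2 * (length (new ext₁) + (length shared + length unshared))
          ≡⟨ solve 3 (λ a b c → con 2 :* (a :+ (b :+ c)) := con 2 :* (a :+ c) :+ con 2 :* b) refl
               (length (new ext₁)) (length shared) (length unshared) ⟩
        2 * (length (new ext₁) + length unshared) + 2 * length shared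
          ≡⟨ cong (λ n → 2 * n + 2 * length shared) (Listₚ.length-++ (new ext₁)) ⟨
        2 * length union + 2 * length shared ∎
        where
        open ℕₚ.≤-Reasoning
        open +-*-Solver

      -- Site 3 touches both outer sites, so its `v` colors are all outside `union`.
      three-sites : ∀ {size₃ g₃} (pos₃ : Position size₃ g₃) → Extends pos₂ pos₃ 3F v →
                    3 * u ≤ 2 * length union →
                    (∀ s → Bounded p (p + q) (cls₃ s) (size₃ s)) → Winnable (history pos₃)
      three-sites pos₃ ext₃ 3u≤ bounded =
        finished (p + q) (3 * u + 2 * v) lower-suffices upper-suffices pos₃ p cls₃ (ℕₚ.m≤m+n p q)
          (from-yes (alternating? cls₃)) bounded (union List.++ new ext₃)
          (Uniqueₚ.++⁺ union-unique (new-unique ext₃) λ { (γ∈ , γ∈₃) →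
            [ new-avoids ext₃ γ∈₃ (from-yes (touch? 3F 0F))
            , new-avoids ext₃ γ∈₃ (from-yes (touch? 3F 6F)) ]′ (union-used γ∈) })
          (λ γ∈ → [ [ (λ used → 0F , keeps ext₃ used) , (λ used → 6F , keeps ext₃ used) ]′ ∘ union-used
                  , (λ γ∈₃ → 3F , new-used ext₃ γ∈₃) ]′ (Lₚ.∈-++⁻ union γ∈))
          (begin
            3 * u + 2 * v                            ≤⟨ ℕₚ.+-mono-≤ 3u≤ (ℕₚ.*-monoʳ-≤ 2 (new-length ext₃)) ⟩
            2 * length union + 2 * length (new ext₃) ≡⟨ ℕₚ.*-distribˡ-+ 2 (length union) (length (new ext₃)) ⟨
            2 * (length union + length (new ext₃))   ≡⟨ cong (2 *_) (Listₚ.length-++ union) ⟨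
            2 * length (union List.++ new ext₃)      ∎)
        where open ℕₚ.≤-Reasoning

      -- A small `union` leaves at least `u / 2` shared colors. Being present at both 0 and 6, they
      -- are barred at 1 and at 5, and the touching sites 1 and 5 force disjoint sets of `u` and `v`
      -- colors.
      four-sites : ∀ {size₃ size₄ g₃ g₄} (pos₃ : Position size₃ g₃) (pos₄ : Position size₄ g₄) →
                   Extends pos₂ pos₃ 1F u → Extends pos₃ pos₄ 5F v → 2 * length union < 3 * u →
                   (∀ s → Bounded q (p + q) (cls₄ s) (size₄ s)) → Winnable (history pos₄)
      four-sites pos₃ pos₄ ext₃ ext₄ <3u bounded =
        finished (p + q) (3 * u + 2 * v) lower-suffices upper-suffices pos₄ q cls₄ (ℕₚ.m≤n+m q p)
          (from-yes (alternating? cls₄)) bounded (shared List.++ (new ext₃ List.++ new ext₄))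
          (Uniqueₚ.++⁺ (Uniqueₚ.filter⁺ _ (new-unique ext₂))
            (Uniqueₚ.++⁺ (new-unique ext₃) (new-unique ext₄) λ { (γ∈₃ , γ∈₄) →
              new-avoids ext₄ γ∈₄ (from-yes (touch? 5F 1F)) (new-used ext₃ γ∈₃) })
            λ { (γ∈ , γ∈′) →
              [ (λ γ∈₃ → new-avoids ext₃ γ∈₃ (from-yes (touch? 1F 0F)) (used-0 (proj₂ (∈-shared γ∈))))
              , (λ γ∈₄ → new-avoids ext₄ γ∈₄ (from-yes (touch? 5F 6F))
                           (keeps ext₃ (new-used ext₂ (proj₁ (∈-shared γ∈))))) ]′
              (Lₚ.∈-++⁻ (new ext₃) γ∈′) })
          (λ γ∈ → [ (λ γ∈ → 0F , keeps ext₄ (keeps ext₃ (used-0 (proj₂ (∈-shared γ∈)))))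
                  , [ (λ γ∈₃ → 1F , keeps ext₄ (new-used ext₃ γ∈₃)) , (λ γ∈₄ → 5F , new-used ext₄ γ∈₄) ]′
                    ∘ Lₚ.∈-++⁻ (new ext₃) ]′ (Lₚ.∈-++⁻ shared γ∈))
          (begin
            3 * u + 2 * v
              ≡⟨ solve 2 (λ u v → con 3 :* u :+ con 2 :* v := u :+ con 2 :* (u :+ v)) refl u v ⟩
            u + 2 * (u + v)
              ≤⟨ ℕₚ.+-mono-≤ u≤2shared (ℕₚ.*-monoʳ-≤ 2 (ℕₚ.+-mono-≤ (new-length ext₃) (new-length ext₄))) ⟩
            2 * length shared + 2 * (length (new ext₃) + length (new ext₄))
              ≡⟨ cong (λ n → 2 * length shared + 2 * n) (Listₚ.length-++ (new ext₃)) ⟨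
            2 * length shared + 2 * length (new ext₃ List.++ new ext₄)
              ≡⟨ ℕₚ.*-distribˡ-+ 2 (length shared) _ ⟨
            2 * (length shared + length (new ext₃ List.++ new ext₄))
              ≡⟨ cong (2 *_) (Listₚ.length-++ shared) ⟨
            2 * length (shared List.++ (new ext₃ List.++ new ext₄)) ∎)
        where
        open ℕₚ.≤-Reasoning
        open +-*-Solver
        u≤2shared : u ≤ 2 * length shared
        u≤2shared = ℕₚ.+-cancelˡ-≤ (3 * u) u (2 * length shared) (begin
          3 * u + u                            ≡⟨ solve 1 (λ u → con 3 :* u :+ u := con 4 :* u) refl u ⟩
          4 * u                                ≤⟨ 4u≤ ⟩
          2 * length union + 2 * length shared ≤⟨ ℕₚ.+-monoˡ-≤ (2 * length shared) (ℕₚ.<⇒≤ <3u) ⟩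
          3 * u + 2 * length shared            ∎)

    presenter-wins : Winnable []
    presenter-wins =
      groups w w-least p start 0F (<G (≤q+ (≤p+ (≤p+ ℕₚ.≤-refl)))) λ pos₁ ext₁ →
      groups w w-least p pos₁ 6F (<G (≤q+ (≤p+ ℕₚ.≤-refl))) λ pos₂ ext₂ →
      -- The test depends only on colors already assigned, so Presenter can perform it.
      branch pos₁ pos₂ ext₁ ext₂ (3 * u ℕₚ.≤? 2 * length (union ext₁ ext₂))
      where
      ≤p+ : ∀ {a b} → a ≤ b → a ≤ p + b
      ≤p+ a≤b = ℕₚ.≤-trans a≤b (ℕₚ.m≤n+m _ p)
      ≤q+ : ∀ {a b} → a ≤ b → a ≤ q + b
      ≤q+ a≤b = ℕₚ.≤-trans a≤b (ℕₚ.m≤n+m _ q)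
      +0≤ : ∀ {a b} → a ≤ b → a + 0 ≤ b
      +0≤ {a} a≤b = ℕₚ.≤-trans (ℕₚ.≤-reflexive (ℕₚ.+-identityʳ a)) a≤b
      size₁ size₂ : Site → ℕ
      size₁ = Vector.updateAt (const 0) 0F (p +_)
      size₂ = Vector.updateAt size₁ 6F (p +_)
      branch : (pos₁ : Position size₁ (p + 0)) (pos₂ : Position size₂ (p + (p + 0)))
               (ext₁ : Extends start pos₁ 0F u) (ext₂ : Extends pos₁ pos₂ 6F u) →
               Dec (3 * u ≤ 2 * length (union ext₁ ext₂)) → Winnable (history pos₂)
      branch pos₁ pos₂ ext₁ ext₂ (yes 3u≤) =
        groups w w-least q pos₂ 3F (<G (ℕₚ.+-monoʳ-≤ q (≤p+ ℕₚ.≤-refl))) λ pos₃ ext₃ →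
        three-sites ext₁ ext₂ pos₃ ext₃ 3u≤ λ
          { 0F → +0≤ ℕₚ.≤-refl ; 1F → refl ; 2F → refl ; 3F → ℕₚ.+-monoʳ-≤ p (+0≤ ℕₚ.≤-refl)
          ; 4F → refl ; 5F → refl ; 6F → +0≤ ℕₚ.≤-refl }
      branch pos₁ pos₂ ext₁ ext₂ (no 3u≰) =
        groups w w-least p pos₂ 1F (<G (≤q+ ℕₚ.≤-refl)) λ pos₃ ext₃ →
        groups w w-least q pos₃ 5F (<G ℕₚ.≤-refl) λ pos₄ ext₄ →
        four-sites ext₁ ext₂ pos₃ pos₄ ext₃ ext₄ (ℕₚ.≰⇒> 3u≰) λ
          { 0F → +0≤ p≤q ; 1F → q+p≤ ; 2F → refl ; 3F → refl
          ; 4F → refl ; 5F → +0≤ ℕₚ.≤-refl ; 6F → q+p≤ }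
        where
        q+p≤ : q + (p + 0) ≤ p + q
        q+p≤ = ℕₚ.≤-reflexive (trans (cong (q +_) (ℕₚ.+-identityʳ p)) (ℕₚ.+-comm q p))

-- Choice of the parameters

⌊a+a+n/2⌋ : ∀ a n → ⌊ a + a + n /2⌋ ≡ a + ⌊ n /2⌋
⌊a+a+n/2⌋ zero    n = refl
⌊a+a+n/2⌋ (suc a) n = trans (cong (λ b → ⌊ suc (b + n) /2⌋) (ℕₚ.+-suc a a)) (cong suc (⌊a+a+n/2⌋ a n))

private
  strategy : ∀ d k m l .{{_ : NonZero d}} .{{_ : NonZero k}} → 2 ^ l ≤ d → d < 2 ^ suc l →
    ∃ λ (σ : Strategy d) → ForcesWhileColorable k σ
      (fromℕ ⌊ 5 * m /2⌋ *ᴿ (fromℕ d ÷ᴿ (log₂ d +ᴿ fromℕ 3) ⟨ 0<log₂n+3 d ⟩))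
      (fromℕ m *ᴿ (fromℚ (ℤ.+ d ℚ./ k) +ᴿ log₂ d +ᴿ fromℕ 3))
  strategy d k m l 2^l≤d d<2^1+l =
    presenter-wins p q w w-least (ℕₚ.⌊n/2⌋≤⌈n/2⌉ m) refl lower-suffices upper-suffices
    where
    p = ⌊ m /2⌋
    q = ⌈ m /2⌉
    -- There are `suc c′ = l + 3` hues, and `h` is half of that, rounded down.
    c′ = l + 2
    h = ⌊ l + 3 /2⌋
    c′≤h+h : c′ ≤ h + h
    c′≤h+h = ℕ.s≤s⁻¹ (begin
      suc (l + 2)     ≡⟨ ℕₚ.+-suc l 2 ⟨
      l + 3           ≡⟨ ℕₚ.⌊n/2⌋+⌈n/2⌉≡n (l + 3) ⟨
      h + ⌈ l + 3 /2⌉ ≤⟨ ℕₚ.+-monoʳ-≤ h (ℕₚ.⌊n/2⌋-mono (ℕₚ.n≤1+n _)) ⟩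
      h + suc h       ≡⟨ ℕₚ.+-suc h h ⟩
      suc (h + h)     ∎)
      where open ℕₚ.≤-Reasoning
    instance
      h≢0 : NonZero h
      h≢0 = ℕ.>-nonZero (ℕₚ.⌊n/2⌋-mono (ℕₚ.≤-trans (ℕₚ.n≤1+n 2) (ℕₚ.m≤n+m 3 l)))
    -- This is `⌈d / h⌉`, as `d` is positive.
    w = suc (ℕ.pred d / h)
    w-least : ∀ n → d ≤ n * h → w ≤ n
    w-least n d≤nh = m<n*o⇒m/o<n (ℕₚ.<-≤-trans (subst (ℕ.pred d <_) (ℕₚ.suc-pred d) (ℕₚ.n<1+n _)) d≤nh)
    d≤wh : d ≤ w * h
    d≤wh = begin
      d                                     ≡⟨ ℕₚ.suc-pred d ⟨
      suc (ℕ.pred d)                        ≡⟨ cong suc (m≡m%n+[m/n]*n (ℕ.pred d) h) ⟩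
      suc (ℕ.pred d % h) + ℕ.pred d / h * h ≤⟨ ℕₚ.+-monoˡ-≤ _ (m%n<n (ℕ.pred d) h) ⟩
      h + ℕ.pred d / h * h                  ∎
      where open ℕₚ.≤-Reasoning
    2h≤l+3 : h * 2 ≤ l + 3
    2h≤l+3 = begin
      h * 2           ≡⟨ solve 1 (λ h → h :* con 2 := h :+ h) refl h ⟩
      h + h           ≤⟨ ℕₚ.+-monoʳ-≤ h (ℕₚ.⌊n/2⌋≤⌈n/2⌉ (l + 3)) ⟩
      h + ⌈ l + 3 /2⌉ ≡⟨ ℕₚ.⌊n/2⌋+⌈n/2⌉≡n (l + 3) ⟩
      l + 3           ∎
      where open ℕₚ.≤-Reasoning
            open +-*-Solver
    p+q≡m : p + q ≡ m
    p+q≡m = ℕₚ.⌊n/2⌋+⌈n/2⌉≡n m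
    -- `⌊ 5 * m /2⌋` equals `2 * m + p`, which is `3 * p + 2 * q`.
    ⌊5m/2⌋w≡ : ⌊ 5 * m /2⌋ * w ≡ 3 * (p * w) + 2 * (q * w)
    ⌊5m/2⌋w≡ = begin
      ⌊ 5 * m /2⌋ * w
        ≡⟨ cong (λ n → ⌊ n /2⌋ * w)
             (solve 1 (λ m → con 5 :* m := con 2 :* m :+ con 2 :* m :+ m) refl m) ⟩
      ⌊ 2 * m + 2 * m + m /2⌋ * w
        ≡⟨ cong (_* w) (⌊a+a+n/2⌋ (2 * m) m) ⟩
      (2 * m + p) * w
        ≡⟨ cong (λ n → (2 * n + p) * w) p+q≡m ⟨
      (2 * (p + q) + p) * w
        ≡⟨ solve 3 (λ p q w → (con 2 :* (p :+ q) :+ p) :* w := con 3 :* (p :* w) :+ con 2 :* (q :* w))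
             refl p q w ⟩
      3 * (p * w) + 2 * (q * w) ∎
      where open ≡-Reasoning
            open +-*-Solver
    lower upper : ℝ
    lower = fromℕ ⌊ 5 * m /2⌋ *ᴿ (fromℕ d ÷ᴿ (log₂ d +ᴿ fromℕ 3) ⟨ 0<log₂n+3 d ⟩)
    upper = fromℕ m *ᴿ (fromℚ (ℤ.+ d ℚ./ k) +ᴿ log₂ d +ᴿ fromℕ 3)
    lower-suffices : ∀ N → 3 * (p * w) + 2 * (q * w) ≤ 2 * N → lower ≤ᴿ fromℕ N
    lower-suffices N le = lower-bound d l h w ⌊ 5 * m /2⌋ N 2^l≤d 2h≤l+3 d≤wh
      (subst (_≤ 2 * N) (sym ⌊5m/2⌋w≡) le)
    upper-suffices : ∀ N → N ≤ (p + q) * (d / k + suc c′) → fromℕ N ≤ᴿ upper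
    upper-suffices N le = upper-bound d k m l N 2^l≤d
      (subst₂ (λ m c → N ≤ m * (d / k + c)) p+q≡m (sym (ℕₚ.+-suc l 2)) le)
    open Groups d k (suc (q + (p + (p + (p + 0))))) c′ h
      lower upper c′≤h+h
      (ℕₚ.<-≤-trans d<2^1+l (ℕₚ.^-monoʳ-≤ 2 (subst (suc l ≤_) (ℕₚ.+-comm 2 l) (ℕₚ.n≤1+n (suc l)))))

theorem4 : ∀ (d k m : ℕ) .{{_ : NonZero d}} .{{_ : NonZero k}} .{{_ : NonZero m}} → 2 ≤ d →
    ∃ λ (σ : Strategy d) → ForcesWhileColorable k σ
    (fromℕ ⌊ 5 * m /2⌋ *ᴿ (fromℕ d ÷ᴿ (log₂ d +ᴿ fromℕ 3) ⟨ 0<log₂n+3 d ⟩))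
    (fromℕ m *ᴿ (fromℚ (ℤ.+ d ℚ./ k) +ᴿ log₂ d +ᴿ fromℕ 3))
theorem4 d k m _ = let l , 2^l≤d , d<2^1+l = 2^l≤d<2^[1+l] d in strategy d k m l 2^l≤d d<2^1+l
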